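{- Let $n>1$ be an integer and let $(\mathcal{F},\mathcal{G})$ be a Cross-Sperner pair of families of subsets of $[n]=\{1,\dots,n\}$ such that $|\mathcal{I}(\mathcal{F},\mathcal{G})|=m(n)$. Then there exist disjoint sets $X,Y$ with $X\cup Y=[n]$ and $\{|X|,|Y|\}=\{\lfloor n/2\rfloor,\lceil n/2\rceil\}$ such that $\mathcal{F}=\{A\cup Y: A\subsetneq X\}$ and $\mathcal{G}=\{B\cup X: B\subsetneq Y\}$. In particular, $m(n)=2^n-2^{\lfloor n/2\rfloor}-2^{\lceil n/2\rceil}+1$ for all $n>1$.
   Context: A pair $(\mathcal{F},\mathcal{G})$ of families $\mathcal{F},\mathcal{G}\subseteq 2^{[n]}$ is called Cross-Sperner if for all $A\in\mathcal{F}$ and $B\in\mathcal{G}$, neither $A\subseteq B$ nor $B\subseteq A$. For families $\mathcal{F},\mathcal{G}$ set $\mathcal{I}(\mathcal{F},\mathcal{G})=\{A\cap B: A\in\mathcal{F},B\in\mathcal{G}\}$, and define $m(n)=\max\{|\mathcal{I}(\mathcal{F},\mathcal{G})|: \mathcal{F},\mathcal{G}\subseteq 2^{[n]}\text{ form a Cross-Sperner pair}\}$. Here $A\subsetneq X$ means $A$ is a proper subset of $X$ (possibly empty). -}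

module Defs where

open import Data.Nat using (ℕ; zero; suc)
open import Data.Bool using (Bool; true; false; _∧_; T)
import Data.Bool as Bool
open import Data.List using (List; []; _∷_; _++_; map; filter; length)
open import Data.Bool.ListAction using (any)
open import Data.Vec using (_∷_; [])
open import Data.Vec.Properties using (≡-dec)
open import Data.Fin.Subset using (Subset; inside; outside; _∩_; _⊆_)
open import Data.Product using (_×_; Σ)
open import Relation.Binary.PropositionalEquality using (_≡_)
open import Data.Nat using (_≤_)
open import Relation.Nullary using (¬_)
open import Relation.Nullary.Decidable using (⌊_⌋)

Family : ℕ → Set
Family n = Subset n → Bool

allSubsets : (n : ℕ) → List (Subset n)
allSubsets zero    = [] ∷ []
allSubsets (suc n) = map (inside ∷_) (allSubsets n) ++ map (outside ∷_) (allSubsets n)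

_∈F_ : {n : ℕ} → Subset n → Family n → Set
A ∈F F = T (F A)

card : {n : ℕ} → Family n → ℕ
card {n} F = length (filter (λ A → Bool.T? (F A)) (allSubsets n))

_==_ : {n : ℕ} → Subset n → Subset n → Bool
A == B = ⌊ ≡-dec Bool._≟_ A B ⌋

I : {n : ℕ} → Family n → Family n → Family n
I {n} F G C = any (λ A → any (λ B → F A ∧ (G B ∧ ((A ∩ B) == C))) (allSubsets n)) (allSubsets n)

CrossSperner : {n : ℕ} → Family n → Family n → Set
CrossSperner F G = ∀ A B → A ∈F F → B ∈F G → ¬ (A ⊆ B) × ¬ (B ⊆ A)

IsMaxCrossIntersections : (n : ℕ) → ℕ → Set
IsMaxCrossIntersections n k =
  Σ (Family n) (λ F → Σ (Family n) (λ G → CrossSperner F G × card (I F G) ≡ k))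
  × (∀ (F G : Family n) → CrossSperner F G → card (I F G) ≤ k)

{-# OPTIONS --safe #-}
module Submission where

-- Let U and V be the up-closures of F and G. No member of I F G lies in U ∪ V, while
-- U ∪ V ⊆ I U V, so |I F G| + |U ∪ V| + ℓ ≤ 2^n, where ℓ is the number of sets outside I U V;
-- also |I F G| ≤ |U ∖ V| |V ∖ U|. If |I F G| reaches the claimed maximum, these bounds force ℓ = 0:
-- for even n this is the inequality of arithmetic and geometric means, and for n = 2k + 1 one uses in
-- addition that ℓ ≥ (2^(k+1) - |U|) (2^(k+1) - |V|), which is proved by induction on the dimension
-- with the help of the Harris-Kleitman inequality.
-- Now ℓ = 0 says that the empty set is A ∩ B for some A ∈ F and B ∈ G. Then U ∪ V contains all
-- supersets of A and all supersets of the complement of A, hence at least 2^|∁A| + 2^|A| - 1 sets.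
-- This is at least 2^⌊n/2⌋ + 2^⌈n/2⌉ - 1, and equality throughout determines F and G.

open import Defs
open import Data.Bool using (Bool; true; false; _∧_; _∨_; not; T; if_then_else_; T?) renaming (_≟_ to _≟ᵇ_)
open import Data.Bool.Properties using (T-∧; T-∨)
open import Data.Empty using (⊥-elim)
open import Data.Fin.Properties using (¬∀⟶∃¬)
open import Data.Fin.Subset using (Subset; inside; outside; _∈_; _∉_; _∩_; _∪_; _⊆_; _⊈_; _⊂_; ⊥; ⊤; ∁; ∣_∣)
open import Data.Fin.Subset.Properties
open import Data.List using (List; []; _∷_; map; filter; length)
open import Data.List.Properties using (length-++; filter-++)
open import Data.List.Membership.Propositional using (lose) renaming (_∈_ to _∈ˡ_)
open import Data.List.Membership.Propositional.Properties using (∈-map⁺; ∈-++⁺ˡ; ∈-++⁺ʳ)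
open import Data.List.Relation.Unary.Any using (here; satisfied)
open import Data.List.Relation.Unary.Any.Properties using (any⁺; any⁻)
open import Data.Nat using (ℕ; zero; suc; z≤n; s≤s; _≤_; _<_; _+_; _*_; _∸_; _^_; ⌊_/2⌋; ⌈_/2⌉; NonZero)
open import Data.Nat.Properties
open import Data.Nat.Tactic.RingSolver using (solve-∀)
open import Data.Product using (Σ; ∃; ∃₂; _×_; _,_; proj₁; proj₂)
open import Data.Sum using (_⊎_; inj₁; inj₂; [_,_]′; swap)
open import Data.Vec using ([]; _∷_; here)
open import Data.Vec.Properties using (≡-dec; ∷-injectiveʳ)
open import Function using (_∘_; id; const)
open import Function.Bundles using (_⇔_; mk⇔; module Equivalence)
open import Relation.Nullary using (¬_; yes; no)
open import Relation.Nullary.Decidable using (⌊_⌋; toWitness; fromWitness; decidable-stable; _×-dec_; _→-dec_)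
open import Relation.Binary.PropositionalEquality
  using (_≡_; refl; sym; trans; cong; cong₂; subst; subst₂; module ≡-Reasoning)

-- Families of sets, inclusion and counting

private variable n : ℕ

infixr 6 _∪ᶠ_
infixr 7 _∩ᶠ_
infix 4 _⊑_

_∪ᶠ_ _∩ᶠ_ : Family n → Family n → Family n
(f ∪ᶠ g) A = f A ∨ g A
(f ∩ᶠ g) A = f A ∧ g A

∁ᶠ : Family n → Family n
∁ᶠ f A = not (f A)

_⊑_ : Family n → Family n → Set
f ⊑ g = ∀ A → A ∈F f → A ∈F g

withᶠ withoutᶠ : Family (suc n) → Family n
withᶠ f A = f (inside ∷ A)
withoutᶠ f A = f (outside ∷ A)

T-not⁺ : ∀ b → ¬ T b → T (not b)
T-not⁺ true  ¬t = ¬t _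
T-not⁺ false _  = _

T-not⁻ : ∀ b → T (not b) → ¬ T b
T-not⁻ false _ ()

T-∧⁺ : ∀ {x y} → T x → T y → T (x ∧ y)
T-∧⁺ p q = Equivalence.from T-∧ (p , q)

T-∧⁻ : ∀ {x y} → T (x ∧ y) → T x × T y
T-∧⁻ = Equivalence.to T-∧

T-∨⁺ : ∀ {x y} → T x ⊎ T y → T (x ∨ y)
T-∨⁺ = Equivalence.from T-∨

T-∨⁻ : ∀ {x y} → T (x ∨ y) → T x ⊎ T y
T-∨⁻ = Equivalence.to T-∨

-- Unlike card, this recursion exposes the two halves of a family determined by a point.
count : Family n → ℕ
count {zero}  f = if f [] then 1 else 0
count {suc n} f = count (withᶠ f) + count (withoutᶠ f)

length-filter-map : {A B : Set} (g : A → B) (p : B → Bool) (xs : List A) →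
  length (filter (λ y → T? (p y)) (map g xs)) ≡ length (filter (λ x → T? (p (g x))) xs)
length-filter-map g p [] = refl
length-filter-map g p (x ∷ xs) with p (g x)
... | true  = cong suc (length-filter-map g p xs)
... | false = length-filter-map g p xs

card≡count : (f : Family n) → card f ≡ count f
card≡count {zero} f with f []
... | true  = refl
... | false = refl
card≡count {suc n} f
  rewrite filter-++ (λ A → T? (f A)) (map (inside ∷_) (allSubsets n)) (map (outside ∷_) (allSubsets n))
        | length-++ (filter (λ A → T? (f A)) (map (inside ∷_) (allSubsets n)))
                    {filter (λ A → T? (f A)) (map (outside ∷_) (allSubsets n))}
        | length-filter-map (inside ∷_) f (allSubsets n)
        | length-filter-map (outside ∷_) f (allSubsets n)
  = cong₂ _+_ (card≡count (withᶠ f)) (card≡count (withoutᶠ f))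

count-mono : {f g : Family n} → f ⊑ g → count f ≤ count g
count-mono {zero} {f} {g} f⊑g with f [] | g [] | f⊑g []
... | false | _     | _ = z≤n
... | true  | true  | _ = ≤-refl
... | true  | false | k = ⊥-elim (k _)
count-mono {suc n} f⊑g = +-mono-≤ (count-mono (f⊑g ∘ (inside ∷_))) (count-mono (f⊑g ∘ (outside ∷_)))

count-∪-∩ : (f g : Family n) → count (f ∪ᶠ g) + count (f ∩ᶠ g) ≡ count f + count g
count-∪-∩ {zero} f g with f [] | g []
... | true  | true  = refl
... | true  | false = refl
... | false | true  = refl
... | false | false = refl
count-∪-∩ {suc n} f g =
  trans (interchange (count (withᶠ (f ∪ᶠ g))) _ _ _)
  (trans (cong₂ _+_ (count-∪-∩ (withᶠ f) (withᶠ g)) (count-∪-∩ (withoutᶠ f) (withoutᶠ g)))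
         (interchange (count (withᶠ f)) _ _ _))
  where
  interchange : ∀ a b c d → (a + b) + (c + d) ≡ (a + c) + (b + d)
  interchange = solve-∀

count-∪-≤ : (f g : Family n) → count (f ∪ᶠ g) ≤ count f + count g
count-∪-≤ f g = ≤-trans (m≤m+n _ _) (≤-reflexive (count-∪-∩ f g))

count-∁ : (f : Family n) → count f + count (∁ᶠ f) ≡ 2 ^ n
count-∁ {zero} f with f []
... | true  = refl
... | false = refl
count-∁ {suc n} f =
  trans (rearrange (count (withᶠ f)) _ _ _)
        (cong₂ _+_ (count-∁ (withᶠ f)) (trans (count-∁ (withoutᶠ f)) (sym (+-identityʳ _))))
  where
  rearrange : ∀ a b c d → (a + b) + (c + d) ≡ (a + c) + (b + d)
  rearrange = solve-∀

count-∅ : {f : Family n} → (∀ A → ¬ A ∈F f) → count f ≡ 0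
count-∅ {zero} {f} empty with f [] | empty []
... | true  | k = ⊥-elim (k _)
... | false | _ = refl
count-∅ {suc n} empty = cong₂ _+_ (count-∅ (empty ∘ (inside ∷_))) (count-∅ (empty ∘ (outside ∷_)))

count≡0⇒∅ : (f : Family n) → count f ≡ 0 → ∀ A → ¬ A ∈F f
count≡0⇒∅ {zero} f eq [] fA with f []
... | true  = 1+n≢0 eq
... | false = fA
count≡0⇒∅ {suc n} f eq (true  ∷ A) = count≡0⇒∅ (withᶠ f) (m+n≡0⇒m≡0 _ eq) A
count≡0⇒∅ {suc n} f eq (false ∷ A) = count≡0⇒∅ (withoutᶠ f) (m+n≡0⇒n≡0 (count (withᶠ f)) eq) A

∈⇒1≤count : (f : Family n) (A : Subset n) → A ∈F f → 1 ≤ count f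
∈⇒1≤count f A A∈f with count f in eq
... | zero  = ⊥-elim (count≡0⇒∅ f eq A A∈f)
... | suc _ = s≤s z≤n

count-disjoint : {f g h : Family n} → (∀ A → A ∈F f → ¬ A ∈F g) → f ⊑ h → g ⊑ h →
  count f + count g ≤ count h
count-disjoint {f = f} {g} {h} disj f⊑h g⊑h = begin
  count f + count g                   ≡⟨ count-∪-∩ f g ⟨
  count (f ∪ᶠ g) + count (f ∩ᶠ g)     ≡⟨ cong (count (f ∪ᶠ g) +_) (count-∅ empty) ⟩
  count (f ∪ᶠ g) + 0                  ≡⟨ +-identityʳ _ ⟩
  count (f ∪ᶠ g)                      ≤⟨ count-mono (λ A → [ f⊑h A , g⊑h A ]′ ∘ T-∨⁻) ⟩
  count h                             ∎
  where
  open ≤-Reasoning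
  empty : ∀ A → ¬ A ∈F (f ∩ᶠ g)
  empty A p = let (a , b) = T-∧⁻ {f A} p in disj A a b

count-split : (f g : Family n) → count f ≡ count (f ∩ᶠ ∁ᶠ g) + count (f ∩ᶠ g)
count-split {zero} f g with f [] | g []
... | true  | true  = refl
... | true  | false = refl
... | false | true  = refl
... | false | false = refl
count-split {suc n} f g =
  trans (cong₂ _+_ (count-split (withᶠ f) (withᶠ g)) (count-split (withoutᶠ f) (withoutᶠ g)))
        (rearrange (count (withᶠ (f ∩ᶠ ∁ᶠ g))) _ _ _)
  where
  rearrange : ∀ a b c d → (a + b) + (c + d) ≡ (a + c) + (b + d)
  rearrange = solve-∀

-- A member of `g` outside `f` would make `g` strictly larger. This turns tight size bounds into
-- equality of families in the extremal case.
⊑-antisym-count : {f g : Family n} → f ⊑ g → count g ≤ count f → g ⊑ f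
⊑-antisym-count {f = f} {g} f⊑g ∣g∣≤∣f∣ A A∈g with T? (f A)
... | yes A∈f = A∈f
... | no  A∉f = ⊥-elim (count≡0⇒∅ (g ∩ᶠ ∁ᶠ f) (n≤0⇒n≡0 (+-cancelˡ-≤ (count f) _ 0 bound)) A
                          (T-∧⁺ A∈g (T-not⁺ (f A) A∉f)))
  where
  bound : count f + count (g ∩ᶠ ∁ᶠ f) ≤ count f + 0
  bound = ≤-trans
    (count-disjoint (λ B B∈f B∈g∖f → T-not⁻ (f B) (proj₂ (T-∧⁻ {g B} B∈g∖f)) B∈f)
                    f⊑g (λ B → proj₁ ∘ T-∧⁻ {g B}))
    (≤-trans ∣g∣≤∣f∣ (m≤m+n _ 0))

-- Pairwise intersections

∈-allSubsets : (A : Subset n) → A ∈ˡ allSubsets n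
∈-allSubsets [] = here refl
∈-allSubsets (true  ∷ A) = ∈-++⁺ˡ (∈-map⁺ (inside ∷_) (∈-allSubsets A))
∈-allSubsets (false ∷ A) = ∈-++⁺ʳ _ (∈-map⁺ (outside ∷_) (∈-allSubsets A))

∈I⁺ : (F G : Family n) {A B C : Subset n} → A ∈F F → B ∈F G → A ∩ B ≡ C → C ∈F I F G
∈I⁺ F G {A} {B} A∈F B∈G refl =
  any⁺ _ (lose (∈-allSubsets A) (any⁺ _ (lose (∈-allSubsets B)
    (T-∧⁺ {F A} A∈F (T-∧⁺ {G B} B∈G (fromWitness {a? = ≡-dec _≟ᵇ_ (A ∩ B) (A ∩ B)} refl))))))

∈I⁻ : (F G : Family n) (C : Subset n) → C ∈F I F G → ∃₂ λ A B → A ∈F F × B ∈F G × A ∩ B ≡ C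
∈I⁻ {n} F G C C∈I with satisfied (any⁻ _ (allSubsets n) C∈I)
... | A , pA with satisfied (any⁻ _ (allSubsets n) pA)
... | B , pAB =
  let (A∈F , q) = T-∧⁻ {F A} pAB
      (B∈G , A∩B≡C) = T-∧⁻ {G B} q
  in A , B , A∈F , B∈G , toWitness {a? = ≡-dec _≟ᵇ_ (A ∩ B) C} A∩B≡C

I-mono : {F F′ G G′ : Family n} → F ⊑ F′ → G ⊑ G′ → I F G ⊑ I F′ G′
I-mono {F = F} {F′} {G} {G′} F⊑F′ G⊑G′ C C∈I =
  let (A , B , A∈F , B∈G , eq) = ∈I⁻ F G C C∈I in ∈I⁺ F′ G′ (F⊑F′ A A∈F) (G⊑G′ B B∈G) eq

with-I : (F G : Family (suc n)) → withᶠ (I F G) ⊑ I (withᶠ F) (withᶠ G)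
with-I F G C C∈I with ∈I⁻ F G (inside ∷ C) C∈I
... | true  ∷ A , true  ∷ B , A∈F , B∈G , eq = ∈I⁺ (withᶠ F) (withᶠ G) A∈F B∈G (∷-injectiveʳ eq)
... | true  ∷ A , false ∷ B , A∈F , B∈G , ()
... | false ∷ A , _     ∷ B , A∈F , B∈G , ()

-- An intersection lacks the first point when at least one of the two sets does, which leaves three
-- types of pairs.
without-I : (F G : Family (suc n)) → withoutᶠ (I F G) ⊑
  (I (withᶠ F) (withoutᶠ G) ∪ᶠ I (withoutᶠ F) (withᶠ G)) ∪ᶠ I (withoutᶠ F) (withoutᶠ G)
without-I F G C C∈I with ∈I⁻ F G (outside ∷ C) C∈I
... | true  ∷ A , true  ∷ B , A∈F , B∈G , ()
... | true  ∷ A , false ∷ B , A∈F , B∈G , eq =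
  T-∨⁺ (inj₁ (T-∨⁺ (inj₁ (∈I⁺ (withᶠ F) (withoutᶠ G) A∈F B∈G (∷-injectiveʳ eq)))))
... | false ∷ A , true  ∷ B , A∈F , B∈G , eq =
  T-∨⁺ (inj₁ (T-∨⁺ {I (withᶠ F) (withoutᶠ G) C}
    (inj₂ (∈I⁺ (withoutᶠ F) (withᶠ G) A∈F B∈G (∷-injectiveʳ eq)))))
... | false ∷ A , false ∷ B , A∈F , B∈G , eq =
  T-∨⁺ {(I (withᶠ F) (withoutᶠ G) ∪ᶠ I (withoutᶠ F) (withᶠ G)) C}
    (inj₂ (∈I⁺ (withoutᶠ F) (withoutᶠ G) A∈F B∈G (∷-injectiveʳ eq)))

-- Each pair yields one intersection. Sorting pairs by the first point matches the four types of
-- pairs with the four terms of the expanded product.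
count-I-≤ : (F G : Family n) → count (I F G) ≤ count F * count G
count-I-≤ {zero} F G with F [] | G []
... | true  | true  = ≤-refl
... | true  | false = ≤-refl
... | false | _     = ≤-refl
count-I-≤ {suc n} F G = begin
  count (withᶠ (I F G)) + count (withoutᶠ (I F G))
    ≤⟨ +-mono-≤ (count-mono (with-I F G)) (count-mono (without-I F G)) ⟩
  count (I F₁ G₁) + count ((I F₁ G₀ ∪ᶠ I F₀ G₁) ∪ᶠ I F₀ G₀)
    ≤⟨ +-monoʳ-≤ (count (I F₁ G₁)) (≤-trans (count-∪-≤ (I F₁ G₀ ∪ᶠ I F₀ G₁) (I F₀ G₀))
                                            (+-monoˡ-≤ _ (count-∪-≤ (I F₁ G₀) (I F₀ G₁)))) ⟩
  count (I F₁ G₁) + ((count (I F₁ G₀) + count (I F₀ G₁)) + count (I F₀ G₀))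
    ≤⟨ +-mono-≤ (count-I-≤ F₁ G₁)
         (+-mono-≤ (+-mono-≤ (count-I-≤ F₁ G₀) (count-I-≤ F₀ G₁)) (count-I-≤ F₀ G₀)) ⟩
  count F₁ * count G₁ + ((count F₁ * count G₀ + count F₀ * count G₁) + count F₀ * count G₀)
    ≡⟨ expand (count F₁) (count F₀) (count G₁) (count G₀) ⟩
  (count F₁ + count F₀) * (count G₁ + count G₀) ∎
  where
  open ≤-Reasoning
  F₁ = withᶠ F ; F₀ = withoutᶠ F ; G₁ = withᶠ G ; G₀ = withoutᶠ G
  expand : ∀ a b c d → a * c + ((a * d + b * c) + b * d) ≡ (a + b) * (c + d)
  expand = solve-∀

-- Upsets and the Harris-Kleitman inequality

Upset Downset : Family n → Set
Upset   f = ∀ {A B} → A ⊆ B → A ∈F f → B ∈F f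
Downset f = ∀ {A B} → A ⊆ B → B ∈F f → A ∈F f

∪-absorbs-⊆ : {A B : Subset n} → A ⊆ B → A ∪ B ≡ B
∪-absorbs-⊆ {A = A} {B} A⊆B = ⊆-antisym (λ x∈ → [ A⊆B , id ]′ (x∈p∪q⁻ A B x∈)) (q⊆p∪q A B)

-- If `A ∩ B ⊆ D`, then `(A ∪ D) ∩ (B ∪ D) = (A ∩ B) ∪ D = D`.
I-upset : {U V : Family n} → Upset U → Upset V → Upset (I U V)
I-upset {n} {U} {V} U↑ V↑ {C} {D} C⊆D C∈I =
  let (A , B , A∈U , B∈V , A∩B≡C) = ∈I⁻ U V C C∈I in
  ∈I⁺ U V (U↑ (p⊆p∪q D) A∈U) (V↑ (p⊆p∪q D) B∈V)
    (trans (sym (∪-distribʳ-∩ D A B)) (trans (cong (_∪ D) A∩B≡C) (∪-absorbs-⊆ C⊆D)))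

∁-downset : {U : Family n} → Upset U → Downset (∁ᶠ U)
∁-downset {U = U} U↑ {A} {B} A⊆B B∉U = T-not⁺ (U A) (T-not⁻ (U B) B∉U ∘ U↑ A⊆B)

-- Chebyshev's sum inequality for two terms: the two sides differ by the product of the gaps
-- `p₀ - p₁` and `q₀ - q₁`.
chebyshev : ∀ {p₁ p₀ q₁ q₀} → p₁ ≤ p₀ → q₁ ≤ q₀ →
  (p₁ + p₀) * (q₁ + q₀) ≤ 2 * (p₁ * q₁ + p₀ * q₀)
chebyshev {p} {q₁ = q} p≤ q≤ with m≤n⇒∃[o]m+o≡n p≤ | m≤n⇒∃[o]m+o≡n q≤
... | d , refl | e , refl = ≤-trans (m≤m+n _ (d * e)) (≤-reflexive (identity p d q e))
  where
  identity : ∀ p d q e → (p + (p + d)) * (q + (q + e)) + d * e ≡ 2 * (p * q + (p + d) * (q + e))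
  identity = solve-∀

-- Removing the first point maps the upper half of a downset into its lower half, so the sizes of
-- the halves of `P` and `Q` are ordered alike and `chebyshev` carries the induction.
harris-kleitman : {P Q : Family n} → Downset P → Downset Q →
  count P * count Q ≤ 2 ^ n * count (P ∩ᶠ Q)
harris-kleitman {zero} {P} {Q} _ _ with P [] | Q []
... | true  | true  = ≤-refl
... | true  | false = ≤-refl
... | false | _     = z≤n
harris-kleitman {suc n} {P} {Q} P↓ Q↓ = begin
  (count P₁ + count P₀) * (count Q₁ + count Q₀)
    ≤⟨ chebyshev (count-mono {f = P₁} {P₀} (λ _ → P↓ (out⊆ id))) (count-mono {f = Q₁} {Q₀} (λ _ → Q↓ (out⊆ id))) ⟩
  2 * (count P₁ * count Q₁ + count P₀ * count Q₀)
    ≤⟨ *-monoʳ-≤ 2 (+-mono-≤ (harris-kleitman (P↓ ∘ s⊆s) (Q↓ ∘ s⊆s))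
                             (harris-kleitman (P↓ ∘ s⊆s) (Q↓ ∘ s⊆s))) ⟩
  2 * (2 ^ n * count (P₁ ∩ᶠ Q₁) + 2 ^ n * count (P₀ ∩ᶠ Q₀))
    ≡⟨ factor (2 ^ n) (count (P₁ ∩ᶠ Q₁)) (count (P₀ ∩ᶠ Q₀)) ⟩
  2 ^ suc n * count (P ∩ᶠ Q) ∎
  where
  open ≤-Reasoning
  P₁ = withᶠ P ; P₀ = withoutᶠ P ; Q₁ = withᶠ Q ; Q₀ = withoutᶠ Q
  factor : ∀ N a b → 2 * (N * a + N * b) ≡ 2 * N * (a + b)
  factor = solve-∀

-- Sets missing from the intersections of two upsets

missing : Family n → Family n → ℕ
missing U V = count (∁ᶠ (I U V))

missing-≥ : (U V : Family n) → 2 ^ n ≤ missing U V + count U * count V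
missing-≥ {n} U V = begin
  2 ^ n                              ≡⟨ count-∁ (I U V) ⟨
  count (I U V) + missing U V        ≡⟨ +-comm (count (I U V)) _ ⟩
  missing U V + count (I U V)        ≤⟨ +-monoʳ-≤ (missing U V) (count-I-≤ U V) ⟩
  missing U V + count U * count V    ∎
  where open ≤-Reasoning

∁-anti : {f g : Family n} → f ⊑ g → ∁ᶠ g ⊑ ∁ᶠ f
∁-anti {f = f} {g} f⊑g A A∉g = T-not⁺ (f A) (T-not⁻ (g A) A∉g ∘ f⊑g A)

module _ {U V : Family (suc n)} (U↑ : Upset U) (V↑ : Upset V) where

  private
    U₁ = withᶠ U
    U₀ = withoutᶠ U
    V₁ = withᶠ V
    V₀ = withoutᶠ V
    outer = count (withoutᶠ (∁ᶠ (I U V)))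

    outer⊒ : ∁ᶠ (I U₀ V₁) ∩ᶠ ∁ᶠ (I U₁ V₀) ⊑ withoutᶠ (∁ᶠ (I U V))
    outer⊒ C C∈ = T-not⁺ (I U V (outside ∷ C)) λ C∈I →
      -- Pairs from `U₀` and `V₀` give nothing new, since `U₀ ⊑ U₁` for an upset.
      [ [ C∉₁₀ , C∉₀₁ ]′ ∘ T-∨⁻ , C∉₁₀ ∘ I-mono {F = U₀} {U₁} {V₀} {V₀} (λ _ → U↑ (out⊆ id)) (λ _ → id) C ]′
        (T-∨⁻ {(I U₁ V₀ ∪ᶠ I U₀ V₁) C} (without-I U V C C∈I))
      where
      C∉₀₁ : ¬ C ∈F I U₀ V₁
      C∉₀₁ = T-not⁻ (I U₀ V₁ C) (proj₁ (T-∧⁻ {not (I U₀ V₁ C)} C∈))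
      C∉₁₀ : ¬ C ∈F I U₁ V₀
      C∉₁₀ = T-not⁻ (I U₁ V₀ C) (proj₂ (T-∧⁻ {not (I U₀ V₁ C)} C∈))

  -- A set without the first point is missing from I U V iff it is missing from both I U₀ V₁ and I U₁ V₀,
  -- so Harris-Kleitman applies.
  missing-split : ∃ λ L → missing U₁ V₁ + L ≤ missing U V × missing U₀ V₁ * missing U₁ V₀ ≤ 2 ^ n * L
  missing-split = outer
    , +-monoˡ-≤ outer (count-mono (∁-anti (with-I U V)))
    , ≤-trans (harris-kleitman (∁-downset (I-upset (U↑ ∘ s⊆s) (V↑ ∘ s⊆s)))
                               (∁-downset (I-upset (U↑ ∘ s⊆s) (V↑ ∘ s⊆s))))
              (*-monoʳ-≤ (2 ^ n) (count-mono outer⊒))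

-- In the arithmetic lemmas below, I = 2^i and J = 2^j in dimension i + j + 1; u and v are the sizes of
-- U and V, with indices 1 and 0 for the members with and without the first point, and
-- a = 2I - u, b = 2J - v, g = I - u₁, e = I - u₀, d = J - v₁, f = J - v₀.
-- They are written additively, which avoids truncated subtraction.

-- The difference `2IJ - uv - ab` is `2(u - I)(J - v)`, which is nonnegative because one size is
-- above its midpoint and the other below.
few-pairs : ∀ {I J u a v b L} → u + a ≡ 2 * I → v + b ≡ 2 * J → I ≤ u → v ≤ J →
  2 * (I * J) ≤ L + u * v → a * b ≤ L
few-pairs {I} {J} {u} {a} {v} {b} {L} eqa eqb I≤u v≤J le
  with m≤n⇒∃[o]m+o≡n I≤u | m≤n⇒∃[o]m+o≡n v≤J
... | s , refl | r , refl
  with +-cancelˡ-≡ (I) (s + a) I (trans (sym (+-assoc I s a)) (trans eqa (double I)))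
     | +-cancelˡ-≡ v b (r + (v + r)) (trans eqb (double′ v r))
  where
  double : ∀ x → 2 * x ≡ x + x
  double = solve-∀
  double′ : ∀ x y → 2 * (x + y) ≡ x + (y + (x + y))
  double′ = solve-∀
... | refl | refl = +-cancelʳ-≤ ((s + a + s) * v) _ _
  (≤-trans (≤-trans (m≤m+n _ (2 * s * r)) (≤-reflexive (identity s a v r))) le)
  where
  identity : ∀ s a v r → a * (r + (v + r)) + (s + a + s) * v + 2 * s * r ≡ 2 * ((s + a) * (v + r))
  identity = solve-∀

-- Cancels the factor `N`, the size of the cube, from the Harris-Kleitman inequality.
product-bound : ∀ {N x y L₁ L₂ L c} → .{{NonZero N}} → x ≤ L₁ → y ≤ L₂ → L₁ * L₂ ≤ N * L →
  N * c ≤ x * y → c ≤ L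
product-bound {N} x≤ y≤ le key =
  *-cancelˡ-≤ N (≤-trans key (≤-trans (*-mono-≤ x≤ y≤) le))

-- With `s = u₁ - I` one has `e = s + a` and `e (u₀ + a) = I a + s u₀ ≥ I a`; likewise
-- `f (v₀ + b) ≥ J b`. Multiplying and cancelling `I J` gives `a b`, so the sets without the first
-- point already suffice.
step-large-large : ∀ {I J} u₁ u₀ a v₁ v₀ b e f {L₁ L₂ L} → .{{NonZero (I * J)}} →
  u₁ + (u₀ + a) ≡ 2 * I → v₁ + (v₀ + b) ≡ 2 * J → I ≤ u₁ → J ≤ v₁ → u₀ + e ≡ I → v₀ + f ≡ J →
  e * (v₀ + b) ≤ L₁ → (u₀ + a) * f ≤ L₂ → L₁ * L₂ ≤ I * J * L → a * b ≤ L
step-large-large {I} {J} u₁ u₀ a v₁ v₀ b e f equ eqv I≤u₁ J≤v₁ refl refl le₁ le₂ hk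
  with m≤n⇒∃[o]m+o≡n I≤u₁ | m≤n⇒∃[o]m+o≡n J≤v₁
... | s , refl | t , refl
  with solve-e u₀ e s a equ | solve-e v₀ f t b eqv
  where
  solve-e : ∀ u e s a → u + e + s + (u + a) ≡ 2 * (u + e) → e ≡ s + a
  solve-e u e s a eq = +-cancelˡ-≡ (u + u + e) e (s + a) (trans (lhs u e) (trans (sym eq) (rhs u e s a)))
    where
    lhs : ∀ u e → u + u + e + e ≡ 2 * (u + e)
    lhs = solve-∀
    rhs : ∀ u e s a → u + e + s + (u + a) ≡ u + u + e + (s + a)
    rhs = solve-∀
... | refl | refl = product-bound {c = a * b} le₁ le₂ hk (begin
    (u₀ + (s + a)) * (v₀ + (t + b)) * (a * b)
      ≡⟨ regroup (u₀ + (s + a)) (v₀ + (t + b)) a b ⟩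
    ((u₀ + (s + a)) * a) * ((v₀ + (t + b)) * b)
      ≤⟨ *-mono-≤ (m≤m+n ((u₀ + (s + a)) * a) (s * u₀)) (m≤m+n ((v₀ + (t + b)) * b) (t * v₀)) ⟩
    ((u₀ + (s + a)) * a + s * u₀) * ((v₀ + (t + b)) * b + t * v₀)
      ≡⟨ identity u₀ s a v₀ t b ⟩
    ((s + a) * (v₀ + b)) * ((u₀ + a) * (t + b)) ∎)
  where
  open ≤-Reasoning
  regroup : ∀ p q a b → p * q * (a * b) ≡ (p * a) * (q * b)
  regroup = solve-∀
  identity : ∀ u s a v t b →
    ((u + (s + a)) * a + s * u) * ((v + (t + b)) * b + t * v) ≡ ((s + a) * (v + b)) * ((u + a) * (t + b))
  identity = solve-∀

complement-sum : ∀ {I} u₁ u₀ a g e → u₁ + (u₀ + a) ≡ 2 * I → u₁ + g ≡ I → u₀ + e ≡ I → a ≡ g + e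
complement-sum {I} u₁ u₀ a g e eq eqg eqe = +-cancelˡ-≡ (u₁ + u₀) a (g + e)
  (trans (+-assoc u₁ u₀ a) (trans eq (trans (cong₂ (λ x y → x + (y + 0)) (sym eqg) (sym eqe)) (regroup u₁ g u₀ e))))
  where
  regroup : ∀ p g q e → (p + g) + ((q + e) + 0) ≡ (p + q) + (g + e)
  regroup = solve-∀

-- Here `a = g + e`. The share `g b` is covered by missing sets with the first point and `e b` by
-- those without it; for `U₁` and `V₀` the count of pairs is enough.
step-small-large : ∀ {I J} u₁ u₀ a v₁ v₀ b g e {L₀ L₁ L₂ L} → .{{NonZero (I * J)}} →
  u₁ + (u₀ + a) ≡ 2 * I → v₁ + (v₀ + b) ≡ 2 * J → J ≤ v₁ → u₁ + g ≡ I → u₀ + e ≡ I →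
  g * (v₀ + b) ≤ L₀ → e * (v₀ + b) ≤ L₁ → I * J ≤ L₂ + u₁ * v₀ → L₁ * L₂ ≤ I * J * L → a * b ≤ L₀ + L
step-small-large {I} {J} u₁ u₀ a v₁ v₀ b g e {L₀} {L₁} {L₂} {L} equ eqv J≤v₁ eqg eqe le₀ le₁ le₂ hk
  with complement-sum u₁ u₀ a g e equ eqg eqe
... | refl
  with m≤n⇒∃[o]m+o≡n J≤v₁
... | t , refl
  with solve-J J t v₀ b eqv
  where
  solve-J : ∀ J t v b → J + t + (v + b) ≡ 2 * J → J ≡ t + (v + b)
  solve-J J t v b eq = +-cancelˡ-≡ J J (t + (v + b)) (trans (sym (double J)) (trans (sym eq) (+-assoc J t (v + b))))
    where
    double : ∀ x → 2 * x ≡ x + x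
    double = solve-∀
... | refl with eqg
... | refl = begin
  (g + e) * b      ≡⟨ *-distribʳ-+ b g e ⟩
  g * b + e * b    ≤⟨ +-mono-≤ (≤-trans (*-monoʳ-≤ g (m≤n+m b v₀)) le₀) outer ⟩
  L₀ + L           ∎
  where
  open ≤-Reasoning
  -- This is `I J - u₁ v₀` written without subtraction, where `I = u₁ + g` and `J = t + (v₀ + b)`.
  D = u₁ * (t + b) + g * (t + (v₀ + b))
  D≤L₂ : D ≤ L₂
  D≤L₂ = +-cancelʳ-≤ (u₁ * v₀) _ _ (≤-trans (≤-reflexive (identity u₁ t b g v₀)) le₂)
    where
    identity : ∀ u t b g v → u * (t + b) + g * (t + (v + b)) + u * v ≡ (u + g) * (t + (v + b))
    identity = solve-∀
  outer : e * b ≤ L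
  outer = product-bound {N = (u₁ + g) * (t + (v₀ + b))} {c = e * b} le₁ D≤L₂ hk
    (≤-trans (m≤m+n _ (e * v₀ * (u₁ * t + g * (t + (v₀ + b))))) (≤-reflexive (identity u₁ g t v₀ b e)))
    where
    identity : ∀ u g t v b e →
      (u + g) * (t + (v + b)) * (e * b) + e * v * (u * t + g * (t + (v + b)))
        ≡ (e * (v + b)) * (u * (t + b) + g * (t + (v + b)))
    identity = solve-∀

-- Counting pairs suffices in all three places. With `x = u - I` and `y = v - J`, the bound
-- `I J - u₁ v₁` is `g d + g f + e d` plus `x d + g y`, and the remaining `e f` comes from
-- `L₁ ≥ e J` and `L₂ ≥ I f`.
step-small-small : ∀ {I J} u₁ u₀ a v₁ v₀ b g e d f {L₀ L₁ L₂ L} → .{{NonZero (I * J)}} →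
  u₁ + (u₀ + a) ≡ 2 * I → v₁ + (v₀ + b) ≡ 2 * J → I ≤ u₁ + u₀ → J ≤ v₁ + v₀ →
  u₁ + g ≡ I → u₀ + e ≡ I → v₁ + d ≡ J → v₀ + f ≡ J →
  I * J ≤ L₀ + u₁ * v₁ → I * J ≤ L₁ + u₀ * v₁ → I * J ≤ L₂ + u₁ * v₀ →
  L₁ * L₂ ≤ I * J * L → a * b ≤ L₀ + L
step-small-small u₁ u₀ a v₁ v₀ b g e d f {L₀} {L₁} {L₂} {L}
                 equ eqv I≤u J≤v refl eqe refl eqf le₀ le₁ le₂ hk
  with complement-sum u₁ u₀ a g e equ refl eqe | complement-sum v₁ v₀ b d f eqv refl eqf
     | m≤n⇒∃[o]m+o≡n (+-cancelˡ-≤ u₁ g u₀ I≤u) | m≤n⇒∃[o]m+o≡n (+-cancelˡ-≤ v₁ d v₀ J≤v)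
... | refl | refl | x , refl | y , refl
  with +-cancelˡ-≡ g (x + e) u₁ (trans (sym (+-assoc g x e)) (trans eqe (+-comm u₁ g)))
     | +-cancelˡ-≡ d (y + f) v₁ (trans (sym (+-assoc d y f)) (trans eqf (+-comm v₁ d)))
... | refl | refl = begin
  (g + e) * (d + f)                            ≡⟨ expand g e d f ⟩
  (g * d + g * f + e * d) + e * f              ≤⟨ +-mono-≤ inner outer ⟩
  L₀ + L                                       ∎
  where
  open ≤-Reasoning
  expand : ∀ g e d f → (g + e) * (d + f) ≡ (g * d + g * f + e * d) + e * f
  expand = solve-∀
  inner : g * d + g * f + e * d ≤ L₀
  inner = +-cancelʳ-≤ ((x + e) * (y + f)) _ _
    (≤-trans (≤-trans (m≤m+n _ (x * d + g * y)) (≤-reflexive (identity x e g y f d))) le₀)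
    where
    identity : ∀ x e g y f d → g * d + g * f + e * d + (x + e) * (y + f) + (x * d + g * y)
      ≡ (x + e + g) * (y + f + d)
    identity = solve-∀
  le₁′ : e * (y + f + d) ≤ L₁
  le₁′ = +-cancelʳ-≤ ((g + x) * (y + f)) _ _
    (≤-trans (≤-trans (m≤m+n _ ((g + x) * d)) (≤-reflexive (identity x e g y f d))) le₁)
    where
    identity : ∀ x e g y f d → e * (y + f + d) + (g + x) * (y + f) + (g + x) * d ≡ (x + e + g) * (y + f + d)
    identity = solve-∀
  le₂′ : (x + e + g) * f ≤ L₂
  le₂′ = +-cancelʳ-≤ ((x + e) * (d + y)) _ _
    (≤-trans (≤-trans (m≤m+n _ (g * (d + y))) (≤-reflexive (identity x e g y f d))) le₂)
    where
    identity : ∀ x e g y f d → (x + e + g) * f + (x + e) * (d + y) + g * (d + y) ≡ (x + e + g) * (y + f + d)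
    identity = solve-∀
  outer : e * f ≤ L
  outer = product-bound {N = (x + e + g) * (y + f + d)} {c = e * f} le₁′ le₂′ hk
    (≤-reflexive (regroup (x + e + g) (y + f + d) e f))
    where
    regroup : ∀ p q e f → p * q * (e * f) ≡ (e * q) * (p * f)
    regroup = solve-∀

-- Induction on the dimension for the missing sets

half-≤ : ∀ {x I} → x + x ≤ 2 * I → x ≤ I
half-≤ {x} {I} le = *-cancelˡ-≤ 2 (subst (_≤ 2 * I) (cong (x +_) (sym (+-identityʳ x))) le)

total-≤ : ∀ i j → n ≡ suc (i + j) → (U V : Family n) →
  2 * (2 ^ i * 2 ^ j) ≤ missing U V + count U * count V
total-≤ {n} i j eq U V = ≤-trans
  (≤-reflexive (sym (trans (cong (2 ^_) eq) (cong (2 *_) (^-distribˡ-+-* 2 i j))))) (missing-≥ U V)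

few-pairs-swapped : ∀ i j → n ≡ suc (i + j) → (U V : Family n) → ∀ a b →
  count U + a ≡ 2 * 2 ^ i → count V + b ≡ 2 * 2 ^ j →
  count U ≤ 2 ^ i → 2 ^ j ≤ count V → a * b ≤ missing U V
few-pairs-swapped i j eq U V a b eqa eqb u≤I J≤v =
  subst (_≤ missing U V) (*-comm b a)
    (few-pairs eqb eqa J≤v u≤I
      (subst₂ (λ x y → 2 * x ≤ missing U V + y) (*-comm (2 ^ i) (2 ^ j)) (*-comm (count U) (count V))
        (total-≤ i j eq U V)))

-- One of the families has to reach its lower size bound: the estimate fails for U = V = {⊤}
-- in dimension 3 with i = j = 1.
mutual
  missing-lower-bound : ∀ n i j → n ≡ suc (i + j) → {U V : Family n} → Upset U → Upset V → ∀ a b →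
    count U + a ≡ 2 * 2 ^ i → count V + b ≡ 2 * 2 ^ j →
    2 ^ i ≤ count U ⊎ 2 ^ j ≤ count V → a * b ≤ missing U V
  missing-lower-bound n i j eq {U} {V} U↑ V↑ a b eqa eqb large
    with ≤-total (2 ^ i) (count U) | ≤-total (2 ^ j) (count V)
  ... | inj₁ I≤u | inj₁ J≤v = missing-lower-bound′ n i j eq U↑ V↑ a b eqa eqb I≤u J≤v
  ... | inj₁ I≤u | inj₂ v≤J = few-pairs eqa eqb I≤u v≤J (total-≤ i j eq U V)
  ... | inj₂ u≤I | inj₁ J≤v = few-pairs-swapped i j eq U V a b eqa eqb u≤I J≤v
  ... | inj₂ u≤I | inj₂ v≤J =
    [ (λ I≤u → few-pairs eqa eqb I≤u v≤J (total-≤ i j eq U V))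
    , few-pairs-swapped i j eq U V a b eqa eqb u≤I ]′ large

  -- Both families are large here. Splitting off the first point leaves pairs in one dimension less,
  -- to which the bound applies with one exponent lowered; the four cases record whether `U₁` and
  -- `V₁` alone still reach `I` and `J`.
  missing-lower-bound′ : ∀ n i j → n ≡ suc (i + j) → {U V : Family n} → Upset U → Upset V → ∀ a b →
    count U + a ≡ 2 * 2 ^ i → count V + b ≡ 2 * 2 ^ j →
    2 ^ i ≤ count U → 2 ^ j ≤ count V → a * b ≤ missing U V
  missing-lower-bound′ n i j eq U↑ V↑ zero b eqa eqb I≤u J≤v = z≤n
  missing-lower-bound′ n i j eq {U} {V} U↑ V↑ (suc a) zero eqa eqb I≤u J≤v =
    subst (_≤ missing U V) (sym (*-zeroʳ (suc a))) z≤n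
  -- For `i = 0` a positive deficit from 2 forces `count U ≤ 1 = 2 ^ 0`, so counting pairs is
  -- enough.
  missing-lower-bound′ n zero j eq {U} {V} U↑ V↑ (suc a) (suc b) eqa eqb I≤u J≤v =
    few-pairs-swapped 0 j eq U V (suc a) (suc b) eqa eqb
      (≤-pred (≤-trans (m≤m+n (suc (count U)) a) (≤-reflexive (trans (sym (+-suc (count U) a)) eqa)))) J≤v
  missing-lower-bound′ n i@(suc _) zero eq {U} {V} U↑ V↑ (suc a) (suc b) eqa eqb I≤u J≤v =
    few-pairs eqa eqb I≤u
      (≤-pred (≤-trans (m≤m+n (suc (count V)) b) (≤-reflexive (trans (sym (+-suc (count V) b)) eqb))))
      (total-≤ i 0 eq U V)
  missing-lower-bound′ (suc m) (suc i) (suc j) eq {U} {V} U↑ V↑ a@(suc _) b@(suc _) eqa eqb I≤u J≤v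
    with missing-split U↑ V↑
       -- Since `u₀ ≤ u₁` and `u₁ + u₀ ≤ 2I`, the smaller half has at most `I` members and the
       -- deficit `e` exists; likewise `f`.
       | m≤n⇒∃[o]m+o≡n (half-≤ {u₀} (≤-trans (+-monoˡ-≤ u₀ u₀≤u₁) u≤2I))
       | m≤n⇒∃[o]m+o≡n (half-≤ {v₀} (≤-trans (+-monoˡ-≤ v₀ v₀≤v₁) v≤2J))
       | ≤-total (2 ^ suc i) u₁ | ≤-total (2 ^ suc j) v₁
    where
    u₁ = count (withᶠ U)
    u₀ = count (withoutᶠ U)
    v₁ = count (withᶠ V)
    v₀ = count (withoutᶠ V)
    u₀≤u₁ : u₀ ≤ u₁
    u₀≤u₁ = count-mono {f = withoutᶠ U} {withᶠ U} (λ _ → U↑ (out⊆ id))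
    v₀≤v₁ : v₀ ≤ v₁
    v₀≤v₁ = count-mono {f = withoutᶠ V} {withᶠ V} (λ _ → V↑ (out⊆ id))
    u≤2I : u₁ + u₀ ≤ 2 * 2 ^ suc i
    u≤2I = ≤-trans (m≤m+n _ a) (≤-reflexive eqa)
    v≤2J : v₁ + v₀ ≤ 2 * 2 ^ suc j
    v≤2J = ≤-trans (m≤m+n _ b) (≤-reflexive eqb)
  ... | L , inner+L≤ , hk | e , eqe | f , eqf | big-u | big-v = cases big-u big-v
    where
    U₁ = withᶠ U
    U₀ = withoutᶠ U
    V₁ = withᶠ V
    V₀ = withoutᶠ V
    u₁ = count U₁
    u₀ = count U₀
    v₁ = count V₁
    v₀ = count V₀
    U₁↑ : Upset U₁
    U₁↑ = U↑ ∘ s⊆s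
    U₀↑ : Upset U₀
    U₀↑ = U↑ ∘ s⊆s
    V₁↑ : Upset V₁
    V₁↑ = V↑ ∘ s⊆s
    V₀↑ : Upset V₀
    V₀↑ = V↑ ∘ s⊆s
    IJ≢0 : NonZero (2 ^ suc i * 2 ^ suc j)
    IJ≢0 = m*n≢0 _ _ {{m^n≢0 2 (suc i)}} {{m^n≢0 2 (suc j)}}
    JI≢0 : NonZero (2 ^ suc j * 2 ^ suc i)
    JI≢0 = m*n≢0 _ _ {{m^n≢0 2 (suc j)}} {{m^n≢0 2 (suc i)}}
    eqm : m ≡ suc (i + suc j)
    eqm = suc-injective eq
    eqm′ : m ≡ suc (suc i + j)
    eqm′ = trans eqm (cong suc (+-suc i j))
    2^m : 2 ^ m ≡ 2 ^ suc i * 2 ^ suc j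
    2^m = trans (cong (2 ^_) eqm) (^-distribˡ-+-* 2 (suc i) (suc j))
    equ : u₁ + (u₀ + a) ≡ 2 * 2 ^ suc i
    equ = trans (sym (+-assoc u₁ u₀ a)) eqa
    eqv : v₁ + (v₀ + b) ≡ 2 * 2 ^ suc j
    eqv = trans (sym (+-assoc v₁ v₀ b)) eqb
    hk′ : missing U₀ V₁ * missing U₁ V₀ ≤ 2 ^ suc i * 2 ^ suc j * L
    hk′ = subst (λ N → missing U₀ V₁ * missing U₁ V₀ ≤ N * L) 2^m hk
    hk″ : missing U₁ V₀ * missing U₀ V₁ ≤ 2 ^ suc j * 2 ^ suc i * L
    hk″ = subst₂ (λ x y → x ≤ y * L) (*-comm (missing U₀ V₁) _) (*-comm (2 ^ suc i) _) hk′
    few : ∀ P Q → 2 ^ suc i * 2 ^ suc j ≤ missing P Q + count P * count Q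
    few P Q = subst (_≤ missing P Q + count P * count Q) 2^m (missing-≥ P Q)
    cases : 2 ^ suc i ≤ u₁ ⊎ u₁ ≤ 2 ^ suc i → 2 ^ suc j ≤ v₁ ⊎ v₁ ≤ 2 ^ suc j → a * b ≤ missing U V
    cases (inj₁ I≤u₁) (inj₁ J≤v₁) = ≤-trans
      (step-large-large u₁ u₀ a v₁ v₀ b e f {{IJ≢0}} equ eqv I≤u₁ J≤v₁ eqe eqf
        -- With the exponent `i` the target `2 * 2 ^ i` is `I`, so `e` is the deficit of `U₀`; that
        -- of `V₁` from `2J` is `v₀ + b`.
        (missing-lower-bound m i (suc j) eqm U₀↑ V₁↑ e (v₀ + b) eqe eqv (inj₂ J≤v₁))
        (missing-lower-bound m (suc i) j eqm′ U₁↑ V₀↑ (u₀ + a) f equ eqf (inj₁ I≤u₁))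
        hk′)
      (≤-trans (m≤n+m L _) inner+L≤)
    cases (inj₂ u₁≤I) (inj₁ J≤v₁) =
      let (g , eqg) = m≤n⇒∃[o]m+o≡n u₁≤I in ≤-trans
      (step-small-large u₁ u₀ a v₁ v₀ b g e {{IJ≢0}} equ eqv J≤v₁ eqg eqe
        (missing-lower-bound m i (suc j) eqm U₁↑ V₁↑ g (v₀ + b) eqg eqv (inj₂ J≤v₁))
        (missing-lower-bound m i (suc j) eqm U₀↑ V₁↑ e (v₀ + b) eqe eqv (inj₂ J≤v₁))
        (few U₁ V₀) hk′)
      inner+L≤
    cases (inj₁ I≤u₁) (inj₂ v₁≤J) =
      let (d , eqd) = m≤n⇒∃[o]m+o≡n v₁≤J in ≤-trans
      (subst (_≤ missing U₁ V₁ + L) (*-comm b a)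
        (step-small-large v₁ v₀ b u₁ u₀ a d f {{JI≢0}} eqv equ I≤u₁ eqd eqf
          (subst (_≤ missing U₁ V₁) (*-comm (u₀ + a) d)
            (missing-lower-bound m (suc i) j eqm′ U₁↑ V₁↑ (u₀ + a) d equ eqd (inj₁ I≤u₁)))
          (subst (_≤ missing U₁ V₀) (*-comm (u₀ + a) f)
            (missing-lower-bound m (suc i) j eqm′ U₁↑ V₀↑ (u₀ + a) f equ eqf (inj₁ I≤u₁)))
          (subst₂ (λ x y → x ≤ missing U₀ V₁ + y) (*-comm (2 ^ suc i) _) (*-comm u₀ v₁) (few U₀ V₁))
          hk″))
      inner+L≤
    cases (inj₂ u₁≤I) (inj₂ v₁≤J) =
      let (g , eqg) = m≤n⇒∃[o]m+o≡n u₁≤I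
          (d , eqd) = m≤n⇒∃[o]m+o≡n v₁≤J in ≤-trans
      (step-small-small u₁ u₀ a v₁ v₀ b g e d f {{IJ≢0}} equ eqv I≤u J≤v eqg eqe eqd eqf
        (few U₁ V₁) (few U₀ V₁) (few U₁ V₀) hk′)
      inner+L≤

-- Numerical consequences

-- The two sides differ by the square of the difference of `u` and `v`.
4*product≤square : ∀ u v → 4 * (u * v) ≤ (u + v) * (u + v)
4*product≤square u v = [ below u v
  , (λ v≤u → subst₂ _≤_ (cong (4 *_) (*-comm v u)) (cong₂ _*_ (+-comm v u) (+-comm v u)) (below v u v≤u)) ]′
  (≤-total u v)
  where
  identity : ∀ u d → 4 * (u * (u + d)) + d * d ≡ (u + (u + d)) * (u + (u + d))
  identity = solve-∀
  below : ∀ u v → u ≤ v → 4 * (u * v) ≤ (u + v) * (u + v)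
  below u v u≤v with m≤n⇒∃[o]m+o≡n u≤v
  ... | d , refl = ≤-trans (m≤m+n _ (d * d)) (≤-reflexive (identity u d))

product<square : ∀ u v m → u + v < m + m → u * v < m * m
product<square u v m lt = *-cancelˡ-< 4 _ _ (≤-<-trans (4*product≤square u v)
  (<-≤-trans (*-mono-< lt lt) (≤-reflexive (square m))))
  where
  square : ∀ m → (m + m) * (m + m) ≡ 4 * (m * m)
  square = solve-∀

-- In the next lemmas u = |U∖V|, v = |V∖U|, w = |U∩V| and ℓ is the number of sets missing from I U V.

-- If `ℓ ≥ 1`, then `u + v < 2(K - 1)` although `u v ≥ (K - 1)²`, against the inequality of the
-- means.
no-missing-even : ∀ {K u v w ℓ} → suc (u + v + w + ℓ) ≤ K + K → 1 ≤ w →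
  suc (K * K) ≤ u * v + (K + K) → ℓ ≡ 0
no-missing-even {K} {ℓ = zero} _ _ _ = refl
no-missing-even {zero}  {ℓ = suc ℓ} () _ _
no-missing-even {suc m} {u} {v} {suc w} {suc ℓ} sum _ prod = ⊥-elim (<⇒≱ (product<square u v m sum<) prod≥)
  where
  sum< : u + v < m + m
  sum< = +-cancelʳ-≤ 2 (suc (u + v)) (m + m) (≤-trans (≤-trans (m≤m+n _ (w + ℓ)) (≤-reflexive (lhs u v w ℓ)))
           (≤-trans sum (≤-reflexive (rhs m))))
    where
    lhs : ∀ u v w ℓ → suc (u + v) + 2 + (w + ℓ) ≡ suc (u + v + suc w + suc ℓ)
    lhs = solve-∀
    rhs : ∀ m → suc m + suc m ≡ m + m + 2
    rhs = solve-∀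
  prod≥ : m * m ≤ u * v
  prod≥ = +-cancelʳ-≤ (suc m + suc m) _ _ (≤-trans (≤-reflexive (square m)) prod)
    where
    square : ∀ m → m * m + (suc m + suc m) ≡ suc (suc m * suc m)
    square = solve-∀

-- Suppose `v = K - 2 - d`. Then `u ≤ 3K - 2 - v`, and the right side of the product condition stays
-- at least `extra + 1` below the left one.
factor-large : ∀ {K u v} → suc (suc (u + v)) ≤ K + 2 * K → suc (K * (2 * K)) ≤ u * v + (K + 2 * K) → K ≤ suc v
factor-large {K} {u} {v} sum prod = ≮⇒≥ λ v+2≤K → contra (m≤n⇒∃[o]m+o≡n v+2≤K)
  where
  contra : ¬ ∃ λ d → suc (suc v) + d ≡ K
  contra (d , refl) = <⇒≱ (s≤s (m≤m+n bound extra))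
    (≤-trans (≤-reflexive (identity v d)) (≤-trans prod (+-monoˡ-≤ _ (*-monoˡ-≤ v u≤))))
    where
    bound = (v + v + 3 * d + 4) * v + (suc (suc v) + d + 2 * (suc (suc v) + d))
    extra = v + v * d + 2 * (d * d) + 5 * d + 2
    identity : ∀ v d → suc ((v + v + 3 * d + 4) * v + (suc (suc v) + d + 2 * (suc (suc v) + d))
                           + (v + v * d + 2 * (d * d) + 5 * d + 2))
      ≡ suc ((suc (suc v) + d) * (2 * (suc (suc v) + d)))
    identity = solve-∀
    u≤ : u ≤ v + v + 3 * d + 4
    u≤ = +-cancelʳ-≤ (v + 2) _ _ (≤-trans (≤-reflexive (lhs u v)) (≤-trans sum (≤-reflexive (rhs v d))))
      where
      lhs : ∀ u v → u + (v + 2) ≡ suc (suc (u + v))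
      lhs = solve-∀
      rhs : ∀ v d → suc (suc v) + d + 2 * (suc (suc v) + d) ≡ v + v + 3 * d + 4 + (v + 2)
      rhs = solve-∀

-- The deficits a and b of |U| and |V| from 2K are at least ℓ, while ab ≤ ℓ; so ℓ ≥ 1 leaves only a = b = ℓ = 1.
no-missing-odd : ∀ {K u v w ℓ} → 2 ≤ K → suc (u + v + w + ℓ) ≤ K + 2 * K → 1 ≤ w →
  suc (K * (2 * K)) ≤ u * v + (K + 2 * K) →
  (∀ a b → u + w + a ≡ 2 * K → v + w + b ≡ 2 * K → K ≤ u + w → a * b ≤ ℓ) → ℓ ≡ 0
no-missing-odd {ℓ = zero} _ _ _ _ _ = refl
no-missing-odd {K} {u} {v} {w} {ℓ@(suc l)} 2≤K sum 1≤w prod missing≥ =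
  ⊥-elim (contra-K (≤-pred (≤-trans 2≤K (≤-reflexive (sym (proj₂ K-suc))))))
  where
  sum₂ : suc (suc (u + v)) ≤ K + 2 * K
  sum₂ = ≤-trans (s≤s (≤-trans (≤-reflexive (+-comm 1 (u + v))) (≤-trans (+-monoʳ-≤ (u + v) 1≤w) (m≤m+n _ ℓ)))) sum
  K≤1+v : K ≤ suc v
  K≤1+v = factor-large {K} {u} sum₂ prod
  K≤1+u : K ≤ suc u
  K≤1+u = factor-large {K} {v} (subst (λ x → suc (suc x) ≤ K + 2 * K) (+-comm u v) sum₂)
    (subst (λ x → suc (K * (2 * K)) ≤ x + (K + 2 * K)) (*-comm u v) prod)
  deficit : ∀ x y → suc (x + y + w + ℓ) ≤ K + 2 * K → K ≤ suc y → ∃ λ a → ℓ ≤ a × x + w + a ≡ 2 * K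
  deficit x y s K≤ = let (o , eq) = m≤n⇒∃[o]m+o≡n le in ℓ + o , m≤m+n ℓ o , trans (sym (+-assoc (x + w) ℓ o)) eq
    where
    regroup : ∀ x y w ℓ → suc y + (x + w + ℓ) ≡ suc (x + y + w + ℓ)
    regroup = solve-∀
    le : x + w + ℓ ≤ 2 * K
    le = +-cancelˡ-≤ K _ _ (≤-trans (+-monoˡ-≤ _ K≤) (≤-trans (≤-reflexive (regroup x y w ℓ)) s))
  da = deficit u v sum K≤1+v
  db = deficit v u (subst (λ x → suc (x + w + ℓ) ≤ K + 2 * K) (+-comm u v) sum) K≤1+u
  a = proj₁ da
  b = proj₁ db
  ab≤ℓ : a * b ≤ ℓ
  ab≤ℓ = missing≥ a b (proj₂ (proj₂ da)) (proj₂ (proj₂ db)) (≤-trans K≤1+u (≤-trans (≤-reflexive (+-comm 1 u)) (+-monoʳ-≤ u 1≤w)))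
  ℓ≤1 : ℓ ≤ 1
  ℓ≤1 = *-cancelˡ-≤ ℓ (≤-trans (*-mono-≤ (proj₁ (proj₂ da)) (proj₁ (proj₂ db))) (≤-trans ab≤ℓ (≤-reflexive (sym (*-identityʳ ℓ)))))
  b≤1 : b ≤ 1
  b≤1 = ≤-trans (≤-trans (≤-reflexive (sym (*-identityˡ b))) (*-monoˡ-≤ b (≤-trans (s≤s z≤n) (proj₁ (proj₂ da))))) (≤-trans ab≤ℓ ℓ≤1)
  a≤1 : a ≤ 1
  a≤1 = ≤-trans (≤-trans (≤-reflexive (sym (*-identityʳ a))) (*-monoʳ-≤ a (≤-trans (s≤s z≤n) (proj₁ (proj₂ db))))) (≤-trans ab≤ℓ ℓ≤1)
  -- The deficit `b ≤ 1` gives `v + w + 1 ≥ 2K`, which leaves less than `K` for `u` in the sum.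
  u<K : u < K
  u<K = +-cancelʳ-≤ (2 * K) _ _ (≤-trans (+-monoʳ-≤ (suc u) (≤-trans (≤-reflexive (sym (proj₂ (proj₂ db)))) (+-monoʳ-≤ (v + w) b≤1)))
     (≤-trans (≤-trans (≤-reflexive (regroup u v w)) (s≤s (+-monoʳ-≤ (u + v + w) (s≤s z≤n)))) sum))
    where
    regroup : ∀ u v w → suc u + (v + w + 1) ≡ suc (u + v + w + 1)
    regroup = solve-∀
  v<K : v < K
  v<K = +-cancelʳ-≤ (2 * K) _ _ (≤-trans (+-monoʳ-≤ (suc v) (≤-trans (≤-reflexive (sym (proj₂ (proj₂ da)))) (+-monoʳ-≤ (u + w) a≤1)))
     (≤-trans (≤-trans (≤-reflexive (regroup u v w)) (s≤s (+-monoʳ-≤ (u + v + w) (s≤s z≤n)))) sum))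
    where
    regroup : ∀ u v w → suc v + (u + w + 1) ≡ suc (u + v + w + 1)
    regroup = solve-∀
  K-suc : ∃ λ m → suc m ≡ K
  K-suc = m≤n⇒∃[o]m+o≡n (≤-trans (s≤s z≤n) 2≤K)
  -- With `K = m + 1` now `u v ≤ m²`, and the product condition becomes `m + m² ≤ 0`.
  contra-K : ¬ 1 ≤ proj₁ K-suc
  contra-K 1≤m with K-suc
  ... | m , refl = <⇒≱ (+-mono-≤ 1≤m (z≤n {m * m})) (+-cancelˡ-≤ (m * m + 3 * m + 3) _ _
    (≤-trans (≤-reflexive (lhs m)) (≤-trans prod (≤-trans (+-monoˡ-≤ _ (*-mono-≤ (≤-pred u<K) (≤-pred v<K))) (≤-reflexive (rhs m))))))
    where
    lhs : ∀ m → m * m + 3 * m + 3 + (m + m * m) ≡ suc (suc m * (2 * suc m))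
    lhs = solve-∀
    rhs : ∀ m → m * m + (suc m + 2 * suc m) ≡ m * m + 3 * m + 3 + 0
    rhs = solve-∀

-- Balanced splittings of n

data Halving (n : ℕ) : Set where
  even : ∀ k → n ≡ k + k → ⌊ n /2⌋ ≡ k → ⌈ n /2⌉ ≡ k → Halving n
  odd  : ∀ k → n ≡ suc (k + k) → ⌊ n /2⌋ ≡ k → ⌈ n /2⌉ ≡ suc k → Halving n

halving : ∀ n → Halving n
halving zero = even 0 refl refl refl
halving (suc zero) = odd 0 refl refl refl
halving (suc (suc n)) with halving n
... | even k eq f c = even (suc k) (cong suc (trans (cong suc eq) (sym (+-suc k k)))) (cong suc f) (cong suc c)
... | odd k eq f c = odd (suc k) (cong (suc ∘ suc) (trans eq (sym (+-suc k k)))) (cong suc f) (cong suc c)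

Balanced : ℕ → ℕ → Set
Balanced x y = (x ≡ ⌊ x + y /2⌋ × y ≡ ⌈ x + y /2⌉) ⊎ (x ≡ ⌈ x + y /2⌉ × y ≡ ⌊ x + y /2⌋)

-- For `y ≥ 2` both exponents on the right are at most `y - 1`, so the right side is at most
-- `2 ^ y`.
balanced-extreme : ∀ y → 1 + 2 ^ y ≤ 2 ^ ⌊ y /2⌋ + 2 ^ ⌈ y /2⌉ → (0 ≡ ⌊ y /2⌋) × (y ≡ ⌈ y /2⌉)
balanced-extreme zero _ = refl , refl
balanced-extreme (suc zero) _ = refl , refl
balanced-extreme (suc (suc y)) le = ⊥-elim (<⇒≱ le (≤-trans
  (+-mono-≤ (^-monoʳ-≤ 2 (≤-pred (⌊n/2⌋<n (suc y)))) (^-monoʳ-≤ 2 (≤-pred (⌈n/2⌉<n y))))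
  (≤-reflexive (cong (2 ^ suc y +_) (sym (+-identityʳ _))))))

-- Lowering both exponents by one halves both sides, so everything reduces to the case where one
-- exponent is zero.
2^x+2^y-minimal⇒balanced : ∀ x y → 2 ^ x + 2 ^ y ≤ 2 ^ ⌊ x + y /2⌋ + 2 ^ ⌈ x + y /2⌉ → Balanced x y
2^x+2^y-minimal⇒balanced zero y le = inj₁ (balanced-extreme y le)
2^x+2^y-minimal⇒balanced (suc x) zero le rewrite +-identityʳ x =
  let (p , q) = balanced-extreme (suc x) (≤-trans (≤-reflexive (+-comm 1 (2 ^ suc x))) le) in inj₂ (q , p)
2^x+2^y-minimal⇒balanced (suc x) (suc y) le rewrite +-suc x y =
  [ (λ (p , q) → inj₁ (cong suc p , cong suc q)) , (λ (p , q) → inj₂ (cong suc p , cong suc q)) ]′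
    (2^x+2^y-minimal⇒balanced x y (*-cancelˡ-≤ 2
      (≤-trans (≤-reflexive (*-distribˡ-+ 2 (2 ^ x) (2 ^ y))) (≤-trans le
        (≤-reflexive (sym (*-distribˡ-+ 2 (2 ^ ⌊ x + y /2⌋) (2 ^ ⌈ x + y /2⌉))))))))

⊈⇒∃ : (p q : Subset n) → p ⊈ q → ∃ λ x → x ∈ p × x ∉ q
⊈⇒∃ {n} p q p⊈q with ¬∀⟶∃¬ n (λ x → x ∈ p → x ∈ q) (λ x → (x ∈? p) →-dec (x ∈? q)) (λ f → p⊈q (λ {x} → f x))
... | x , ¬imp = x , decidable-stable (x ∈? p) (λ x∉p → ¬imp (⊥-elim ∘ x∉p)) , λ x∈q → ¬imp (const x∈q)

-- Up-closures and principal upsets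

upClosure : Family n → Family n
upClosure F B = ⌊ anySubset? (λ A → T? (F A) ×-dec (A ⊆? B)) ⌋

∈upClosure⁺ : (F : Family n) {A B : Subset n} → A ∈F F → A ⊆ B → B ∈F upClosure F
∈upClosure⁺ F {A} {B} A∈F A⊆B =
  fromWitness {a? = anySubset? (λ A → T? (F A) ×-dec (A ⊆? B))} (A , A∈F , A⊆B)

∈upClosure⁻ : (F : Family n) (B : Subset n) → B ∈F upClosure F → ∃ λ A → A ∈F F × A ⊆ B
∈upClosure⁻ F B = toWitness {a? = anySubset? (λ A → T? (F A) ×-dec (A ⊆? B))}

upClosure-upset : (F : Family n) → Upset (upClosure F)
upClosure-upset F {A} {B} A⊆B A∈ =
  let (C , C∈F , C⊆A) = ∈upClosure⁻ F A A∈ in ∈upClosure⁺ F C∈F (⊆-trans C⊆A A⊆B)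

⊑-upClosure : (F : Family n) → F ⊑ upClosure F
⊑-upClosure F A A∈F = ∈upClosure⁺ F A∈F ⊆-refl

↑ : Subset n → Family n
↑ A S = ⌊ A ⊆? S ⌋

∈↑⁺ : {A S : Subset n} → A ⊆ S → S ∈F ↑ A
∈↑⁺ {A = A} {S} A⊆S = fromWitness {a? = A ⊆? S} A⊆S

∈↑⁻ : (A : Subset n) {S : Subset n} → S ∈F ↑ A → A ⊆ S
∈↑⁻ A {S} = toWitness {a? = A ⊆? S}

count-cong : {f g : Family n} → f ⊑ g → g ⊑ f → count f ≡ count g
count-cong f⊑g g⊑f = ≤-antisym (count-mono f⊑g) (count-mono g⊑f)

count-↑ : (A : Subset n) → count (↑ A) ≡ 2 ^ ∣ ∁ A ∣
count-↑ [] = refl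
count-↑ (true ∷ A) = trans
  (cong₂ _+_ (count-cong {f = withᶠ (↑ (true ∷ A))} {↑ A} (λ _ → ∈↑⁺ ∘ drop-∷-⊆ ∘ ∈↑⁻ (true ∷ A)) (λ _ → ∈↑⁺ ∘ in⊆in ∘ ∈↑⁻ A))
    (count-∅ {f = withoutᶠ (↑ (true ∷ A))} (λ S S∈ → not-below S (∈↑⁻ (true ∷ A) S∈))))
  (trans (+-identityʳ _) (count-↑ A))
  where
  not-below : ∀ S → ¬ (true ∷ A) ⊆ (false ∷ S)
  not-below S sub with sub here
  ... | ()
count-↑ (false ∷ A) = cong₂ _+_ (half true) (trans (half false) (sym (+-identityʳ _)))
  where
  half : ∀ s → count (λ S → ↑ (false ∷ A) (s ∷ S)) ≡ 2 ^ ∣ ∁ A ∣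
  half s = trans (count-cong {f = λ S → ↑ (false ∷ A) (s ∷ S)} {↑ A}
    (λ _ → ∈↑⁺ ∘ drop-∷-⊆ ∘ ∈↑⁻ (false ∷ A)) (λ _ → ∈↑⁺ ∘ out⊆ ∘ ∈↑⁻ A)) (count-↑ A)

∣A∣+∣∁A∣ : (A : Subset n) → ∣ A ∣ + ∣ ∁ A ∣ ≡ n
∣A∣+∣∁A∣ A = trans (cong (∣ A ∣ +_) (∣∁p∣≡n∸∣p∣ A)) (m+[n∸m]≡n (∣p∣≤n A))

∣∁∁A∣ : (A : Subset n) → ∣ ∁ (∁ A) ∣ ≡ ∣ A ∣
∣∁∁A∣ A = +-cancelˡ-≡ ∣ ∁ A ∣ _ _ (trans (∣A∣+∣∁A∣ (∁ A)) (trans (sym (∣A∣+∣∁A∣ A)) (+-comm ∣ A ∣ _)))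

⊆-cover : (A : Subset n) {S : Subset n} → A ⊆ S → ∁ A ⊆ S → ∀ B → B ⊆ S
⊆-cover A A⊆S ∁A⊆S B {x} _ with x ∈? A
... | yes x∈A = A⊆S x∈A
... | no  x∉A = ∁A⊆S (x∉p⇒x∈∁p x∉A)

-- The successor accounts for `⊤`, the only set above both `A` and `∁ A`.
count-↑∪↑∁ : (A : Subset n) → suc (count (↑ A ∪ᶠ ↑ (∁ A))) ≡ 2 ^ ∣ ∁ A ∣ + 2 ^ ∣ A ∣
count-↑∪↑∁ {n} A = begin
  suc (count (↑ A ∪ᶠ ↑ (∁ A)))                           ≡⟨ +-comm 1 _ ⟩
  count (↑ A ∪ᶠ ↑ (∁ A)) + 1                             ≡⟨ cong (count (↑ A ∪ᶠ ↑ (∁ A)) +_) meet ⟨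
  count (↑ A ∪ᶠ ↑ (∁ A)) + count (↑ A ∩ᶠ ↑ (∁ A))        ≡⟨ count-∪-∩ (↑ A) (↑ (∁ A)) ⟩
  count (↑ A) + count (↑ (∁ A))                          ≡⟨ cong₂ _+_ (count-↑ A) (trans (count-↑ (∁ A)) (cong (2 ^_) (∣∁∁A∣ A))) ⟩
  2 ^ ∣ ∁ A ∣ + 2 ^ ∣ A ∣                                ∎
  where
  open ≡-Reasoning
  meet : count (↑ A ∩ᶠ ↑ (∁ A)) ≡ 1
  meet = trans
    (count-cong {f = ↑ A ∩ᶠ ↑ (∁ A)} {↑ ⊤}
      (λ S S∈ → let (p , q) = T-∧⁻ {↑ A S} S∈ in ∈↑⁺ (⊆-cover A (∈↑⁻ A p) (∈↑⁻ (∁ A) q) ⊤))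
      (λ S S∈ → T-∧⁺ {↑ A S} (∈↑⁺ (⊆-trans (⊆-max A) (∈↑⁻ ⊤ S∈))) (∈↑⁺ (⊆-trans (⊆-max (∁ A)) (∈↑⁻ ⊤ S∈)))))
    (trans (count-↑ (⊤ {n})) (cong (2 ^_) (trans (∣∁p∣≡n∸∣p∣ (⊤ {n})) (trans (cong (n ∸_) (∣⊤∣≡n n)) (n∸n≡0 n)))))

swap-∩ᶠ : (f g : Family n) → f ∩ᶠ g ⊑ g ∩ᶠ f
swap-∩ᶠ f g A A∈ = let (p , q) = T-∧⁻ {f A} A∈ in T-∧⁺ {g A} q p

count-∪₃ : (U V : Family n) →
  count (U ∪ᶠ V) ≡ count (U ∩ᶠ ∁ᶠ V) + count (V ∩ᶠ ∁ᶠ U) + count (U ∩ᶠ V)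
count-∪₃ U V = +-cancelʳ-≡ (count (U ∩ᶠ V)) _ _ (begin
  count (U ∪ᶠ V) + w                     ≡⟨ count-∪-∩ U V ⟩
  count U + count V                      ≡⟨ cong₂ _+_ (count-split U V) (count-split V U) ⟩
  (u + w) + (v + count (V ∩ᶠ U))         ≡⟨ cong (λ x → (u + w) + (v + x)) (count-cong (swap-∩ᶠ V U) (swap-∩ᶠ U V)) ⟩
  (u + w) + (v + w)                      ≡⟨ regroup u v w ⟩
  u + v + w + w                          ∎)
  where
  open ≡-Reasoning
  u = count (U ∩ᶠ ∁ᶠ V)
  v = count (V ∩ᶠ ∁ᶠ U)
  w = count (U ∩ᶠ V)
  regroup : ∀ u v w → (u + w) + (v + w) ≡ u + v + w + w
  regroup = solve-∀

nonempty : (f : Family n) → 1 ≤ count f → ∃ λ A → A ∈F f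
nonempty f 1≤ with anySubset? (T? ∘ f)
... | yes A∈f = A∈f
... | no  none = ⊥-elim (<⇒≱ 1≤ (≤-reflexive (count-∅ (λ A A∈f → none (A , A∈f)))))

flip-sperner : {F G : Family n} → CrossSperner F G → CrossSperner G F
flip-sperner cs A B A∈G B∈F = let (p , q) = cs B A B∈F A∈G in q , p

I-comm : (F G : Family n) → I F G ⊑ I G F
I-comm F G C C∈I = let (A , B , A∈F , B∈G , eq) = ∈I⁻ F G C C∈I in ∈I⁺ G F B∈G A∈F (trans (∩-comm B A) eq)

module _ {F G : Family n} (cs : CrossSperner F G) where

  -- A member of `F` below `A ∩ B` would lie below `B`, a member of `G`.
  I∩upClosure : ∀ C → C ∈F I F G → ¬ C ∈F upClosure F
  I∩upClosure C C∈I C∈U =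
    let (A , B , A∈F , B∈G , eq) = ∈I⁻ F G C C∈I
        (A′ , A′∈F , A′⊆C) = ∈upClosure⁻ F C C∈U
    in proj₁ (cs A′ B A′∈F B∈G) (⊆-trans (subst (A′ ⊆_) (sym eq) A′⊆C) (p∩q⊆q A B))

  ⊑-upClosure-∖ : F ⊑ upClosure F ∩ᶠ ∁ᶠ (upClosure G)
  ⊑-upClosure-∖ A A∈F = T-∧⁺ (⊑-upClosure F A A∈F) (T-not⁺ (upClosure G A) λ A∈V →
    let (B , B∈G , B⊆A) = ∈upClosure⁻ G A A∈V in proj₂ (cs A B A∈F B∈G) B⊆A)

module _ {F G : Family n} (cs : CrossSperner F G) where

  private
    U = upClosure F
    V = upClosure G

  I-outside : ∀ C → C ∈F I F G → ¬ C ∈F (U ∪ᶠ V)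
  I-outside C C∈I = [ I∩upClosure cs C C∈I , I∩upClosure (flip-sperner cs) C (I-comm F G C C∈I) ]′ ∘ T-∨⁻

  count-I≤product : count (I F G) ≤ count (U ∩ᶠ ∁ᶠ V) * count (V ∩ᶠ ∁ᶠ U)
  count-I≤product = ≤-trans (count-I-≤ F G)
    (*-mono-≤ (count-mono (⊑-upClosure-∖ cs)) (count-mono (⊑-upClosure-∖ (flip-sperner cs))))

  module _ (⊤∈U : ⊤ ∈F U) (⊤∈V : ⊤ ∈F V) where

    -- `I F G` and `U ∪ᶠ V` are disjoint inside `I U V`: each member of the union is its own
    -- intersection with `⊤`, which lies in both upsets.
    count-I+∪+missing : count (I F G) + (count (U ∪ᶠ V) + missing U V) ≤ 2 ^ n
    count-I+∪+missing = begin
      count (I F G) + (count (U ∪ᶠ V) + missing U V)   ≡⟨ +-assoc (count (I F G)) _ _ ⟨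
      count (I F G) + count (U ∪ᶠ V) + missing U V     ≤⟨ +-monoˡ-≤ (missing U V) (count-disjoint I-outside
                                                            (I-mono (⊑-upClosure F) (⊑-upClosure G)) ∪⊑I) ⟩
      count (I U V) + missing U V                      ≡⟨ count-∁ (I U V) ⟩
      2 ^ n                                            ∎
      where
      open ≤-Reasoning
      ∪⊑I : U ∪ᶠ V ⊑ I U V
      ∪⊑I A A∈ = [ (λ A∈U → ∈I⁺ U V A∈U ⊤∈V (∩-identityʳ A)) , (λ A∈V → ∈I⁺ U V ⊤∈U A∈V (∩-identityˡ A)) ]′
        (T-∨⁻ {U A} A∈)

sum≤product : ∀ {p q} → 2 ≤ p → 2 ≤ q → p + q ≤ p * q
sum≤product {suc (suc p)} {suc (suc q)} _ _ = ≤-trans (m≤m+n _ (p + q + p * q)) (≤-reflexive (identity p q))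
  where
  identity : ∀ p q → (2 + p) + (2 + q) + (p + q + p * q) ≡ (2 + p) * (2 + q)
  identity = solve-∀
sum≤product {suc zero} (s≤s ()) _
sum≤product {suc (suc _)} {suc zero} _ (s≤s ())

2≤2^ : ∀ {k} → 1 ≤ k → 2 ≤ 2 ^ k
2≤2^ = ^-monoʳ-≤ 2

∈↑∪↑⁻ : (A B : Subset n) {S : Subset n} → S ∈F (↑ A ∪ᶠ ↑ B) → A ⊆ S ⊎ B ⊆ S
∈↑∪↑⁻ A B {S} S∈ with T-∨⁻ {↑ A S} S∈
... | inj₁ p = inj₁ (∈↑⁻ A p)
... | inj₂ p = inj₂ (∈↑⁻ B p)

-- Families with many intersections

-- What is extracted from a pair reaching the bound, with `∁ Y` as the set `X` of the theorem. The
-- field `size` is the opposite inequality and also provides the upper bound on the maximum.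
record Extremal {n : ℕ} (F G : Family n) (Y : Subset n) : Set where
  field
    Y∈F      : Y ∈F F
    ∁Y∈G     : ∁ Y ∈F G
    balanced : (∣ ∁ Y ∣ ≡ ⌊ n /2⌋ × ∣ Y ∣ ≡ ⌈ n /2⌉) ⊎ (∣ ∁ Y ∣ ≡ ⌈ n /2⌉ × ∣ Y ∣ ≡ ⌊ n /2⌋)
    F-above  : ∀ S → S ∈F F → Y ⊆ S ⊎ ∁ Y ⊆ S
    G-above  : ∀ S → S ∈F G → Y ⊆ S ⊎ ∁ Y ⊆ S
    I-full   : ∀ C → Y ⊈ C → ∁ Y ⊈ C → C ∈F I F G
    size     : count (I F G) + (2 ^ ⌊ n /2⌋ + 2 ^ ⌈ n /2⌉) ≤ suc (2 ^ n)

module _ (n : ℕ) (1<n : 1 < n) where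

  private
    P = 2 ^ ⌊ n /2⌋
    Q = 2 ^ ⌈ n /2⌉

  PQ≡2^n : P * Q ≡ 2 ^ n
  PQ≡2^n = trans (sym (^-distribˡ-+-* 2 ⌊ n /2⌋ ⌈ n /2⌉)) (cong (2 ^_) (⌊n/2⌋+⌈n/2⌉≡n n))

  2≤P : 2 ≤ P
  2≤P = 2≤2^ (⌊n/2⌋-mono 1<n)

  P+Q≤2^n : P + Q ≤ 2 ^ n
  P+Q≤2^n = ≤-trans (sum≤product 2≤P (2≤2^ (⌈n/2⌉-mono (≤-trans (s≤s z≤n) 1<n)))) (≤-reflexive PQ≡2^n)

  module _ {F G : Family n} (cs : CrossSperner F G) (big : suc (2 ^ n) ≤ count (I F G) + (P + Q)) where

    private
      U = upClosure F
      V = upClosure G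
      u = count (U ∩ᶠ ∁ᶠ V)
      v = count (V ∩ᶠ ∁ᶠ U)
      w = count (U ∩ᶠ V)

    -- As `P + Q ≤ 2 ^ n`, the hypothesis `big` leaves at least one intersection; hence both
    -- families are nonempty.
    I-member : ∃ λ C → C ∈F I F G
    I-member = nonempty (I F G) (+-cancelʳ-≤ (P + Q) _ _ (≤-trans (s≤s P+Q≤2^n) big))

    F-member : ∃ λ A → A ∈F F
    F-member = let (C , C∈I) = I-member
                   (A , B , A∈F , B∈G , _) = ∈I⁻ F G C C∈I in A , A∈F

    G-member : ∃ λ B → B ∈F G
    G-member = let (C , C∈I) = I-member
                   (A , B , A∈F , B∈G , _) = ∈I⁻ F G C C∈I in B , B∈G

    ⊤∈U : ⊤ ∈F U
    ⊤∈U = let (A , A∈F) = F-member in ∈upClosure⁺ F A∈F (⊆-max A)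

    ⊤∈V : ⊤ ∈F V
    ⊤∈V = let (B , B∈G) = G-member in ∈upClosure⁺ G B∈G (⊆-max B)

    total : count (I F G) + (count (U ∪ᶠ V) + missing U V) ≤ 2 ^ n
    total = count-I+∪+missing cs ⊤∈U ⊤∈V

    sizes : suc (u + v + w + missing U V) ≤ P + Q
    sizes = +-cancelˡ-≤ (count (I F G)) _ _ (≤-trans (≤-reflexive (+-suc (count (I F G)) _))
      (≤-trans (s≤s (subst (λ s → count (I F G) + (s + missing U V) ≤ 2 ^ n) (count-∪₃ U V) total)) big))

    product : suc (P * Q) ≤ u * v + (P + Q)
    product = ≤-trans (≤-reflexive (cong suc PQ≡2^n)) (≤-trans big (+-monoˡ-≤ (P + Q) (count-I≤product cs)))

    1≤w : 1 ≤ w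
    1≤w = ∈⇒1≤count (U ∩ᶠ V) ⊤ (T-∧⁺ {U ⊤} ⊤∈U ⊤∈V)

    no-missing : missing U V ≡ 0
    no-missing with halving n
    ... | even k n≡ f c = no-missing-even {2 ^ k} {u} {v} {w}
      (subst₂ (λ x y → suc (u + v + w + missing U V) ≤ 2 ^ x + 2 ^ y) f c sizes) 1≤w
      (subst₂ (λ x y → suc (2 ^ x * 2 ^ y) ≤ u * v + (2 ^ x + 2 ^ y)) f c product)
    -- For odd `n` the powers are `P = K` and `Q = 2K` with `K = 2 ^ k`.
    ... | odd k n≡ f c = no-missing-odd {2 ^ k} {u} {v} {w} (subst (λ x → 2 ≤ 2 ^ x) f 2≤P)
      (subst₂ (λ x y → suc (u + v + w + missing U V) ≤ 2 ^ x + 2 ^ y) f c sizes) 1≤w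
      (subst₂ (λ x y → suc (2 ^ x * 2 ^ y) ≤ u * v + (2 ^ x + 2 ^ y)) f c product)
      λ a b eqa eqb K≤ → missing-lower-bound n k k n≡ (upClosure-upset F) (upClosure-upset G) a b
        (trans (cong (_+ a) (count-split U V)) eqa)
        (trans (cong (_+ b) (trans (count-split V U) (cong (v +_) (count-cong (swap-∩ᶠ V U) (swap-∩ᶠ U V))))) eqb)
        (inj₁ (≤-trans K≤ (≤-reflexive (sym (count-split U V)))))

    ⊥∈I : ⊥ ∈F I U V
    ⊥∈I = decidable-stable (T? (I U V ⊥)) λ ⊥∉I → count≡0⇒∅ (∁ᶠ (I U V)) no-missing ⊥ (T-not⁺ (I U V ⊥) ⊥∉I)

    -- Disjoint members of the two up-closures contain members of `F` and `G`, which are then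
    -- disjoint too.
    disjoint-pair : ∃₂ λ A B → A ∈F F × B ∈F G × B ⊆ ∁ A
    disjoint-pair with ∈I⁻ U V ⊥ ⊥∈I
    ... | A′ , B′ , A′∈U , B′∈V , A′∩B′≡⊥ with ∈upClosure⁻ F A′ A′∈U | ∈upClosure⁻ G B′ B′∈V
    ... | A , A∈F , A⊆A′ | B , B∈G , B⊆B′ = A , B , A∈F , B∈G , λ x∈B →
      x∉p⇒x∈∁p λ x∈A → ∉⊥ (subst (_ ∈_) A′∩B′≡⊥ (x∈p∩q⁺ (A⊆A′ x∈A , B⊆B′ x∈B)))

    module DisjointPair (Y B₀ : Subset n) (Y∈F : Y ∈F F) (B₀∈G : B₀ ∈F G) (B₀⊆∁Y : B₀ ⊆ ∁ Y) where

      private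
        X = ∁ Y

      principal⊑ : ↑ Y ∪ᶠ ↑ X ⊑ U ∪ᶠ V
      principal⊑ S S∈ =
        [ (λ p → T-∨⁺ {U S} (inj₁ (∈upClosure⁺ F Y∈F (∈↑⁻ Y p))))
        , (λ p → T-∨⁺ {U S} (inj₂ (∈upClosure⁺ G B₀∈G (⊆-trans B₀⊆∁Y (∈↑⁻ X p))))) ]′ (T-∨⁻ {↑ Y S} S∈)

      I-∪≤ : count (I F G) + count (U ∪ᶠ V) ≤ 2 ^ n
      I-∪≤ = ≤-trans (+-monoʳ-≤ (count (I F G)) (m≤m+n _ _)) total

      powers≤ : count (I F G) + (2 ^ ∣ X ∣ + 2 ^ ∣ Y ∣) ≤ suc (2 ^ n)
      powers≤ = ≤-trans (≤-reflexive (trans (cong (count (I F G) +_) (sym (count-↑∪↑∁ Y))) (+-suc (count (I F G)) _)))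
        (s≤s (≤-trans (+-monoʳ-≤ (count (I F G)) (count-mono principal⊑)) I-∪≤))

      ∣X∣+∣Y∣ : ∣ X ∣ + ∣ Y ∣ ≡ n
      ∣X∣+∣Y∣ = trans (+-comm ∣ X ∣ _) (∣A∣+∣∁A∣ Y)

      balanced : (∣ X ∣ ≡ ⌊ n /2⌋ × ∣ Y ∣ ≡ ⌈ n /2⌉) ⊎ (∣ X ∣ ≡ ⌈ n /2⌉ × ∣ Y ∣ ≡ ⌊ n /2⌋)
      balanced = subst (λ m → (∣ X ∣ ≡ ⌊ m /2⌋ × ∣ Y ∣ ≡ ⌈ m /2⌉) ⊎ (∣ X ∣ ≡ ⌈ m /2⌉ × ∣ Y ∣ ≡ ⌊ m /2⌋)) ∣X∣+∣Y∣
        (2^x+2^y-minimal⇒balanced ∣ X ∣ ∣ Y ∣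
          (subst (λ m → 2 ^ ∣ X ∣ + 2 ^ ∣ Y ∣ ≤ 2 ^ ⌊ m /2⌋ + 2 ^ ⌈ m /2⌉) (sym ∣X∣+∣Y∣)
            (+-cancelˡ-≤ (count (I F G)) _ _ (≤-trans powers≤ big))))

      powers≡ : 2 ^ ∣ X ∣ + 2 ^ ∣ Y ∣ ≡ P + Q
      powers≡ = [ (λ (x , y) → cong₂ (λ a b → 2 ^ a + 2 ^ b) x y)
                , (λ (x , y) → trans (cong₂ (λ a b → 2 ^ a + 2 ^ b) x y) (+-comm Q P)) ]′ balanced

      upper : count (I F G) + (P + Q) ≤ suc (2 ^ n)
      upper = subst (λ s → count (I F G) + s ≤ suc (2 ^ n)) powers≡ powers≤

      principal-count : suc (count (↑ Y ∪ᶠ ↑ X)) ≡ P + Q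
      principal-count = trans (count-↑∪↑∁ Y) powers≡

      -- `big` leaves at most `P + Q - 1` sets for `U ∪ᶠ V`, exactly the size of the principal part
      -- inside it.
      ∪⊑principal : U ∪ᶠ V ⊑ ↑ Y ∪ᶠ ↑ X
      ∪⊑principal = ⊑-antisym-count {f = ↑ Y ∪ᶠ ↑ X} {U ∪ᶠ V} principal⊑ (≤-pred (begin
        suc (count (U ∪ᶠ V))         ≤⟨ +-cancelˡ-≤ (count (I F G)) (suc (count (U ∪ᶠ V))) (P + Q) I-∪< ⟩
        P + Q                        ≡⟨ principal-count ⟨
        suc (count (↑ Y ∪ᶠ ↑ X))     ∎))
        where
        open ≤-Reasoning
        I-∪< : count (I F G) + suc (count (U ∪ᶠ V)) ≤ count (I F G) + (P + Q)
        I-∪< = ≤-trans (≤-reflexive (+-suc (count (I F G)) (count (U ∪ᶠ V)))) (≤-trans (s≤s I-∪≤) big)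

      above : ∀ S → S ∈F (U ∪ᶠ V) → Y ⊆ S ⊎ X ⊆ S
      above S S∈ = ∈↑∪↑⁻ Y X (∪⊑principal S S∈)

      F-above : ∀ S → S ∈F F → Y ⊆ S ⊎ X ⊆ S
      F-above S S∈F = above S (T-∨⁺ {U S} (inj₁ (⊑-upClosure F S S∈F)))

      G-above : ∀ S → S ∈F G → Y ⊆ S ⊎ X ⊆ S
      G-above S S∈G = above S (T-∨⁺ {U S} (inj₂ (⊑-upClosure G S S∈G)))

      -- `B₀` cannot lie above `Y`, a member of `F`, so it lies above `X`; being inside `X`, it
      -- equals `X`.
      X∈G : X ∈F G
      X∈G = B₀≡X (G-above B₀ B₀∈G)
        where
        B₀≡X : Y ⊆ B₀ ⊎ X ⊆ B₀ → X ∈F G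
        B₀≡X (inj₁ Y⊆B₀) = ⊥-elim (proj₁ (cs Y B₀ Y∈F B₀∈G) Y⊆B₀)
        B₀≡X (inj₂ X⊆B₀) = subst (_∈F G) (⊆-antisym B₀⊆∁Y X⊆B₀) B₀∈G

      -- `I F G` avoids the principal upsets, and by `big` it is as large as their complement.
      outside⊑I : ∁ᶠ (↑ Y ∪ᶠ ↑ X) ⊑ I F G
      outside⊑I = ⊑-antisym-count {f = I F G} {∁ᶠ (↑ Y ∪ᶠ ↑ X)}
        (λ C C∈I → T-not⁺ ((↑ Y ∪ᶠ ↑ X) C) (I-outside cs C C∈I ∘ principal⊑ C))
        (+-cancelʳ-≤ (P + Q) (count (∁ᶠ (↑ Y ∪ᶠ ↑ X))) (count (I F G)) (begin
          count (∁ᶠ (↑ Y ∪ᶠ ↑ X)) + (P + Q)                       ≡⟨ cong (count (∁ᶠ (↑ Y ∪ᶠ ↑ X)) +_) principal-count ⟨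
          count (∁ᶠ (↑ Y ∪ᶠ ↑ X)) + suc (count (↑ Y ∪ᶠ ↑ X))      ≡⟨ +-suc (count (∁ᶠ (↑ Y ∪ᶠ ↑ X))) (count (↑ Y ∪ᶠ ↑ X)) ⟩
          suc (count (∁ᶠ (↑ Y ∪ᶠ ↑ X)) + count (↑ Y ∪ᶠ ↑ X))      ≡⟨ cong suc (+-comm (count (∁ᶠ (↑ Y ∪ᶠ ↑ X))) (count (↑ Y ∪ᶠ ↑ X))) ⟩
          suc (count (↑ Y ∪ᶠ ↑ X) + count (∁ᶠ (↑ Y ∪ᶠ ↑ X)))      ≡⟨ cong suc (count-∁ (↑ Y ∪ᶠ ↑ X)) ⟩
          suc (2 ^ n)                                             ≤⟨ big ⟩
          count (I F G) + (P + Q)                                 ∎))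
        where open ≤-Reasoning

      I-full : ∀ C → Y ⊈ C → X ⊈ C → C ∈F I F G
      I-full C Y⊈C X⊈C = outside⊑I C (T-not⁺ ((↑ Y ∪ᶠ ↑ X) C)
        ([ Y⊈C ∘ ∈↑⁻ Y , X⊈C ∘ ∈↑⁻ X ]′ ∘ T-∨⁻ {↑ Y C}))

    extremal : ∃ λ Y → Extremal F G Y
    extremal = build disjoint-pair
      where
      build : (∃₂ λ A B → A ∈F F × B ∈F G × B ⊆ ∁ A) → ∃ λ Y → Extremal F G Y
      build (Y , B₀ , Y∈F , B₀∈G , B₀⊆∁Y) = Y , record
        { Y∈F      = Y∈F
        ; ∁Y∈G     = D.X∈G
        ; balanced = D.balanced
        ; F-above  = D.F-above
        ; G-above  = D.G-above
        ; I-full   = D.I-full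
        ; size     = D.upper
        }
        where module D = DisjointPair Y B₀ Y∈F B₀∈G B₀⊆∁Y

-- As `X ∈F G` and `Y ∈F F`, members of `F` contain `Y` and members of `G` contain `X`. For `A ⊂ X`,
-- write `A = F₁ ∩ G₁`: since `X ⊆ G₁`, the set `F₁` meets `X` exactly in `A`, so `F₁ = A ∪ Y`.
characterize : {F G : Family n} → CrossSperner F G → (X Y : Subset n) → X ∪ Y ≡ ⊤ →
  Y ∈F F → X ∈F G →
  (∀ S → S ∈F F → Y ⊆ S ⊎ X ⊆ S) → (∀ S → S ∈F G → Y ⊆ S ⊎ X ⊆ S) →
  (∀ C → Y ⊈ C → X ⊈ C → C ∈F I F G) →
  ∀ S → S ∈F F ⇔ (∃ λ A → A ⊂ X × S ≡ A ∪ Y)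
characterize {F = F} {G} cs X Y X∪Y≡⊤ Y∈F X∈G F-above G-above I-full S = mk⇔ to from
  where
  cover : ∀ x → x ∈ X ⊎ x ∈ Y
  cover x = x∈p∪q⁻ X Y (subst (x ∈_) (sym X∪Y≡⊤) ∈⊤)

  F-⊇Y : ∀ S → S ∈F F → Y ⊆ S
  F-⊇Y S S∈F with F-above S S∈F
  ... | inj₁ Y⊆S = Y⊆S
  ... | inj₂ X⊆S = ⊥-elim (proj₂ (cs S X S∈F X∈G) X⊆S)

  G-⊇X : ∀ S → S ∈F G → X ⊆ S
  G-⊇X S S∈G with G-above S S∈G
  ... | inj₁ Y⊆S = ⊥-elim (proj₁ (cs Y S Y∈F S∈G) Y⊆S)
  ... | inj₂ X⊆S = X⊆S

  to : S ∈F F → ∃ λ A → A ⊂ X × S ≡ A ∪ Y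
  to S∈F with ⊈⇒∃ X S (proj₂ (cs S X S∈F X∈G))
  ... | x , x∈X , x∉S = S ∩ X
      , (p∩q⊆q S X , x , x∈X , x∉S ∘ proj₁ ∘ x∈p∩q⁻ S X)
      , ⊆-antisym
          (λ {y} y∈S → x∈p∪q⁺ ([ (λ y∈X → inj₁ (x∈p∩q⁺ (y∈S , y∈X))) , inj₂ ]′ (cover y)))
          (λ y∈ → [ proj₁ ∘ x∈p∩q⁻ S X , F-⊇Y S S∈F ]′ (x∈p∪q⁻ (S ∩ X) Y y∈))

  from : (∃ λ A → A ⊂ X × S ≡ A ∪ Y) → S ∈F F
  from (A , (A⊆X , x , x∈X , x∉A) , refl)
    with ∈I⁻ F G A (I-full A Y⊈A (λ X⊆A → x∉A (X⊆A x∈X)))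
    where
    Y⊈A : Y ⊈ A
    Y⊈A Y⊆A = proj₁ (cs Y X Y∈F X∈G) (λ y∈Y → A⊆X (Y⊆A y∈Y))
  ... | F₁ , G₁ , F₁∈F , G₁∈G , F₁∩G₁≡A = subst (_∈F F) (⊆-antisym F₁⊆ ⊆F₁) F₁∈F
    where
    F₁⊆ : F₁ ⊆ A ∪ Y
    F₁⊆ {y} y∈F₁ = x∈p∪q⁺ ([ (λ y∈X → inj₁ (subst (y ∈_) F₁∩G₁≡A (x∈p∩q⁺ (y∈F₁ , G-⊇X G₁ G₁∈G y∈X)))) , inj₂ ]′ (cover y))
    ⊆F₁ : A ∪ Y ⊆ F₁
    ⊆F₁ {y} y∈ = [ (λ y∈A → p∩q⊆p F₁ G₁ (subst (y ∈_) (sym F₁∩G₁≡A) y∈A)) , F-⊇Y F₁ F₁∈F ]′ (x∈p∪q⁻ A Y y∈)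

-- The construction attaining the bound

subset-of-size : ∀ {k n} → k ≤ n → ∃ λ (A : Subset n) → ∣ A ∣ ≡ k
subset-of-size {n = n} z≤n = ⊥ , ∣⊥∣≡0 n
subset-of-size (s≤s k≤n) = let (A , eq) = subset-of-size k≤n in inside ∷ A , cong suc eq

module _ (X : Subset n) where

  private
    Y = ∁ X

  -- These are the sets `A ∪ Y` with `A ⊊ X` and `B ∪ X` with `B ⊊ Y`, expressed by principal upsets
  -- so that the counts above apply.
  exampleF exampleG : Family n
  exampleF = ↑ Y ∩ᶠ ∁ᶠ (↑ X)
  exampleG = ↑ X ∩ᶠ ∁ᶠ (↑ Y)

  example-sperner : CrossSperner exampleF exampleG
  example-sperner A B A∈F B∈G =
    let (Y⊆A , X⊈A) = T-∧⁻ {↑ Y A} A∈F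
        (X⊆B , Y⊈B) = T-∧⁻ {↑ X B} B∈G
    in (λ A⊆B → T-not⁻ (↑ Y B) Y⊈B (∈↑⁺ (⊆-trans (∈↑⁻ Y Y⊆A) A⊆B)))
     , (λ B⊆A → T-not⁻ (↑ X A) X⊈A (∈↑⁺ (⊆-trans (∈↑⁻ X X⊆B) B⊆A)))

  -- Since `X` and `Y` are disjoint, `C = (C ∪ Y) ∩ (C ∪ X)`.
  example-I : ∁ᶠ (↑ X ∪ᶠ ↑ Y) ⊑ I exampleF exampleG
  example-I C C∉ = ∈I⁺ exampleF exampleG {C ∪ Y} {C ∪ X}
    (T-∧⁺ {↑ Y (C ∪ Y)} (∈↑⁺ (q⊆p∪q C Y)) (T-not⁺ (↑ X (C ∪ Y)) λ X⊆ → X⊈C λ {x} x∈X →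
      [ id , (λ x∈Y → ⊥-elim (x∈∁p⇒x∉p x∈Y x∈X)) ]′ (x∈p∪q⁻ C Y (∈↑⁻ X X⊆ x∈X))))
    (T-∧⁺ {↑ X (C ∪ X)} (∈↑⁺ (q⊆p∪q C X)) (T-not⁺ (↑ Y (C ∪ X)) λ Y⊆ → Y⊈C λ {x} x∈Y →
      [ id , (λ x∈X → ⊥-elim (x∈∁p⇒x∉p x∈Y x∈X)) ]′ (x∈p∪q⁻ C X (∈↑⁻ Y Y⊆ x∈Y))))
    (trans (sym (∪-distribˡ-∩ C Y X)) (trans (cong (C ∪_) (∩-inverseˡ X)) (∪-identityʳ C)))
    where
    X⊈C : X ⊈ C
    X⊈C X⊆C = T-not⁻ ((↑ X ∪ᶠ ↑ Y) C) C∉ (T-∨⁺ (inj₁ (∈↑⁺ X⊆C)))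
    Y⊈C : Y ⊈ C
    Y⊈C Y⊆C = T-not⁻ ((↑ X ∪ᶠ ↑ Y) C) C∉ (T-∨⁺ {↑ X C} (inj₂ (∈↑⁺ Y⊆C)))

  example-count : suc (2 ^ n) ≤ count (I exampleF exampleG) + (2 ^ ∣ X ∣ + 2 ^ ∣ Y ∣)
  example-count = begin
    suc (2 ^ n)                                                  ≡⟨ cong suc (count-∁ (↑ X ∪ᶠ ↑ Y)) ⟨
    suc (count (↑ X ∪ᶠ ↑ Y) + count (∁ᶠ (↑ X ∪ᶠ ↑ Y)))           ≡⟨ +-comm (suc (count (↑ X ∪ᶠ ↑ Y))) _ ⟩
    count (∁ᶠ (↑ X ∪ᶠ ↑ Y)) + suc (count (↑ X ∪ᶠ ↑ Y))           ≤⟨ +-monoˡ-≤ _ (count-mono example-I) ⟩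
    count (I exampleF exampleG) + suc (count (↑ X ∪ᶠ ↑ Y))       ≡⟨ cong (count (I exampleF exampleG) +_) powers ⟩
    count (I exampleF exampleG) + (2 ^ ∣ X ∣ + 2 ^ ∣ Y ∣)        ∎
    where
    open ≤-Reasoning
    powers : suc (count (↑ X ∪ᶠ ↑ Y)) ≡ 2 ^ ∣ X ∣ + 2 ^ ∣ Y ∣
    powers = trans (count-↑∪↑∁ X) (+-comm (2 ^ ∣ Y ∣) _)

-- The value of the maximum

module _ (n : ℕ) (1<n : 1 < n) where

  private
    P = 2 ^ ⌊ n /2⌋
    Q = 2 ^ ⌈ n /2⌉
    m = (2 ^ n ∸ P ∸ Q) + 1

  m+P+Q : m + (P + Q) ≡ suc (2 ^ n)
  m+P+Q = begin
    (2 ^ n ∸ P ∸ Q) + 1 + (P + Q)        ≡⟨ cong (λ x → x + 1 + (P + Q)) (∸-+-assoc (2 ^ n) P Q) ⟩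
    (2 ^ n ∸ (P + Q)) + 1 + (P + Q)      ≡⟨ cong (_+ (P + Q)) (+-comm (2 ^ n ∸ (P + Q)) 1) ⟩
    suc (2 ^ n ∸ (P + Q) + (P + Q))      ≡⟨ cong suc (m∸n+n≡m (P+Q≤2^n n 1<n)) ⟩
    suc (2 ^ n)                          ∎
    where open ≡-Reasoning

  -- Either `I F G` is already within the bound, or it is large enough for `extremal`, whose `size`
  -- gives the bound.
  card-I≤m : (F G : Family n) → CrossSperner F G → card (I F G) ≤ m
  card-I≤m F G cs = subst (_≤ m) (sym (card≡count (I F G))) (+-cancelʳ-≤ (P + Q) _ _
    (≤-trans ([ Extremal.size ∘ proj₂ ∘ extremal n 1<n cs , id ]′ (≤-total (suc (2 ^ n)) (count (I F G) + (P + Q))))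
      (≤-reflexive (sym m+P+Q))))

  attained : ∃₂ λ (F G : Family n) → CrossSperner F G × m ≤ card (I F G)
  attained = from-half (subset-of-size (⌊n/2⌋≤n n))
    where
    from-half : (∃ λ (X : Subset n) → ∣ X ∣ ≡ ⌊ n /2⌋) → ∃₂ λ (F G : Family n) → CrossSperner F G × m ≤ card (I F G)
    from-half (X , ∣X∣) = exampleF X , exampleG X , example-sperner X ,
      subst (m ≤_) (sym (card≡count E)) (+-cancelʳ-≤ (P + Q) m (count E) (begin
        m + (P + Q)                                ≡⟨ m+P+Q ⟩
        suc (2 ^ n)                                ≤⟨ example-count X ⟩
        count E + (2 ^ ∣ X ∣ + 2 ^ ∣ ∁ X ∣)        ≡⟨ cong₂ (λ a b → count E + (2 ^ a + 2 ^ b)) ∣X∣ ∣∁X∣ ⟩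
        count E + (P + Q)                          ∎))
      where
      open ≤-Reasoning
      E : Family n
      E = I (exampleF X) (exampleG X)
      ∣∁X∣ : ∣ ∁ X ∣ ≡ ⌈ n /2⌉
      ∣∁X∣ = +-cancelˡ-≡ ∣ X ∣ _ _ (trans (∣A∣+∣∁A∣ X) (trans (sym (⌊n/2⌋+⌈n/2⌉≡n n)) (cong (_+ ⌈ n /2⌉) (sym ∣X∣))))

  maximum : IsMaxCrossIntersections n m
  maximum = attaining attained , card-I≤m
    where
    attaining : (∃₂ λ (F G : Family n) → CrossSperner F G × m ≤ card (I F G)) →
      Σ (Family n) λ F → Σ (Family n) λ G → CrossSperner F G × card (I F G) ≡ m
    attaining (F , G , cs , m≤) = F , G , cs , ≤-antisym (card-I≤m F G cs) m≤

  maximal⇒large : (F G : Family n) → IsMaxCrossIntersections n (card (I F G)) →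
    suc (2 ^ n) ≤ count (I F G) + (P + Q)
  maximal⇒large F G (_ , maximal) = above attained
    where
    above : (∃₂ λ (F G : Family n) → CrossSperner F G × m ≤ card (I F G)) →
      suc (2 ^ n) ≤ count (I F G) + (P + Q)
    above (F′ , G′ , cs′ , m≤) = subst₂ (λ a b → a ≤ b + (P + Q)) m+P+Q (card≡count (I F G))
      (+-monoˡ-≤ (P + Q) (≤-trans m≤ (maximal F′ G′ cs′)))

theorem1p2 : (n : ℕ) → 1 < n →
    ((F G : Family n) → CrossSperner F G → IsMaxCrossIntersections n (card (I F G)) →
    Σ (Subset n) λ X → Σ (Subset n) λ Y →
    (X ∩ Y ≡ ⊥) × (X ∪ Y ≡ ⊤) ×
    (((∣ X ∣ ≡ ⌊ n /2⌋) × (∣ Y ∣ ≡ ⌈ n /2⌉)) ⊎ ((∣ X ∣ ≡ ⌈ n /2⌉) × (∣ Y ∣ ≡ ⌊ n /2⌋))) ×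
    ((S : Subset n) → (S ∈F F) ⇔ (∃ λ A → (A ⊂ X) × (S ≡ A ∪ Y))) ×
    ((S : Subset n) → (S ∈F G) ⇔ (∃ λ B → (B ⊂ Y) × (S ≡ B ∪ X))))
    × IsMaxCrossIntersections n (((2 ^ n) ∸ (2 ^ ⌊ n /2⌋) ∸ (2 ^ ⌈ n /2⌉)) + 1)
theorem1p2 n 1<n =
  (λ F G cs maximal → structure cs (extremal n 1<n cs (maximal⇒large n 1<n F G maximal))) , maximum n 1<n
  where
  structure : {F G : Family n} → CrossSperner F G → (∃ λ Y → Extremal F G Y) → _
  structure {F} {G} cs (Y , E) = X , Y , ∩-inverseˡ Y , ∪-inverseˡ Y , E.balanced
    , characterize cs X Y (∪-inverseˡ Y) E.Y∈F E.∁Y∈G E.F-above E.G-above E.I-full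
    -- The description of `G` is that of `F` with `X` and `Y` exchanged.
    , characterize (flip-sperner cs) Y X (∪-inverseʳ Y) E.∁Y∈G E.Y∈F
        (λ S → swap ∘ E.G-above S) (λ S → swap ∘ E.F-above S)
        (λ C X⊈C Y⊈C → I-comm F G C (E.I-full C Y⊈C X⊈C))
    where
    module E = Extremal E
    X = ∁ Y
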